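{- Let $\beta,\gamma$ be real numbers with $\gamma\neq 0$. Let $G$ be a simple graph with vertex set $V(G)=\{v_1,\dots,v_n\}$ and edge set $E(G)=\{e_1,\dots,e_m\}$, with diagonal matrix of vertex degrees $D$ and adjacency matrix $A$. Let $\tau_1(G;x)=\det(xI_n-\beta D-\gamma A)$ and $\tau_2(G;x)=\mathrm{per}(xI_n-\beta D-\gamma A)$. Then $$(m-n)\tau_1(G;x)+x\tau_1'(G;x)=\sum_{e\in E(G)}\tau_1(G-e;x)+(\gamma^2-\beta^2)\sum_{v_sv_t\in E(G)}\det\left[(xI_n-\beta D-\gamma A)^{s,t}_{s,t}\right]$$ and $$(m-n)\tau_2(G;x)+x\tau_2'(G;x)=\sum_{e\in E(G)}\tau_2(G-e;x)-(\gamma^2+\beta^2)\sum_{v_sv_t\in E(G)}\mathrm{per}\left[(xI_n-\beta D-\gamma A)^{s,t}_{s,t}\right].$$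
   Context: Graphs are finite and simple. $\mathrm{per}(X)=\sum_{\alpha\in S_n}\prod_{k=1}^n x_{k\alpha(k)}$ is the permanent. $M^{s,t}_{s,t}$ denotes the submatrix of $M$ obtained by deleting rows $s,t$ and columns $s,t$; the determinant and permanent of the empty matrix are $1$. $G-e$ is $G$ with the edge $e$ deleted (keeping all vertices), and $\tau_1(G-e;x)$, $\tau_2(G-e;x)$ are defined by the same formulas using the degree matrix and adjacency matrix of $G-e$ and the same $\beta,\gamma$. The prime denotes the derivative with respect to $x$. Sums over $E(G)$ have one term per (undirected) edge. -}

module Defs where

open import Algebra.Bundles using (CommutativeRing; RawRing)
import Algebra.Definitions.RawMonoid as RawMonoidDefinitions
import Algebra.Definitions.RawSemiring as RawSemiringDefinitions
open import Data.Bool.Base using (Bool; false; T; not; _∧_; _∨_; if_then_else_)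
open import Data.Bool.Properties using (T?; ∧-comm; ∨-comm)
open import Data.Fin.Base as Fin using (Fin; zero; suc; punchIn; punchOut)
import Data.Fin.Properties as Fin
open import Data.Fin.Permutation as Perm using (Permutation′; insert; _⟨$⟩ʳ_)
open import Data.List.Base
  using (List; []; _∷_; [_]; length; map; concatMap; filter; foldr; allFin; cartesianProduct)
open import Data.Nat.Base as ℕ using (ℕ; zero; suc)
import Data.Nat.Properties as ℕ
open import Data.Product.Base using (∃; _×_; _,_)
open import Data.Rational.Base as ℚ using (ℚ; 0ℚ; 1ℚ; ½; ∣_∣)
import Data.Rational.Properties as ℚ
open import Data.Rational.Solver using (module +-*-Solver)
open import Level using (0ℓ)
open import Relation.Binary.PropositionalEquality
  using (_≡_; _≢_; refl; sym; trans; cong; cong₂; subst)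
open import Relation.Nullary using (yes; no; does; contradiction)
open import Relation.Nullary.Decidable using (_×-dec_)

-- Real numbers: Cauchy sequences of rationals, two of them being
-- identified when their difference is a null sequence.

IsCauchy : (ℕ → ℚ) → Set
IsCauchy f = ∀ ε → 0ℚ ℚ.< ε → ∃ λ N → ∀ i j → N ℕ.≤ i → N ℕ.≤ j →
             ∣ f i ℚ.- f j ∣ ℚ.< ε

record ℝ : Set where
  constructor mkℝ
  field
    seq    : ℕ → ℚ
    cauchy : IsCauchy seq

open ℝ

infix 4 _≃_

record _≃_ (x y : ℝ) : Set where
  constructor mk≃
  field
    null : ∀ ε → 0ℚ ℚ.< ε → ∃ λ N → ∀ i → N ℕ.≤ i → ∣ seq x i ℚ.- seq y i ∣ ℚ.< ε

open _≃_

private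

  half : ∀ ε → 0ℚ ℚ.< ε → 0ℚ ℚ.< ½ ℚ.* ε
  half ε 0<ε = subst (ℚ._< ½ ℚ.* ε) (ℚ.*-zeroʳ ½) (ℚ.*-monoʳ-<-pos ½ 0<ε)

  half+half : ∀ ε → ½ ℚ.* ε ℚ.+ ½ ℚ.* ε ≡ ε
  half+half ε = trans (sym (ℚ.*-distribʳ-+ ε ½ ½)) (ℚ.*-identityˡ ε)

  shrink : ∀ K → 0ℚ ℚ.< K → ∀ ε → 0ℚ ℚ.< ε → ∃ λ δ → 0ℚ ℚ.< δ × K ℚ.* δ ≡ ε
  shrink K 0<K ε 0<ε = (ℚ.1/ K) ℚ.* ε , 0<δ , Kδ≡ε
    where
    instance
      pos : ℚ.Positive K
      pos = ℚ.positive 0<K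
      nz : ℚ.NonZero K
      nz = ℚ.pos⇒nonZero K
      pos⁻¹ : ℚ.Positive (ℚ.1/ K)
      pos⁻¹ = ℚ.1/pos⇒pos K
    0<δ : 0ℚ ℚ.< (ℚ.1/ K) ℚ.* ε
    0<δ = subst (ℚ._< (ℚ.1/ K) ℚ.* ε) (ℚ.*-zeroʳ (ℚ.1/ K)) (ℚ.*-monoʳ-<-pos (ℚ.1/ K) 0<ε)
    Kδ≡ε : K ℚ.* ((ℚ.1/ K) ℚ.* ε) ≡ ε
    Kδ≡ε = trans (sym (ℚ.*-assoc K (ℚ.1/ K) ε))
          (trans (cong (ℚ._* ε) (ℚ.*-inverseʳ K)) (ℚ.*-identityˡ ε))

  ∣p-p∣<ε : ∀ p ε → 0ℚ ℚ.< ε → ∣ p ℚ.- p ∣ ℚ.< ε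
  ∣p-p∣<ε p ε 0<ε = subst (λ q → ∣ q ∣ ℚ.< ε) (sym (ℚ.+-inverseʳ p)) 0<ε

  ∣-∣-comm : ∀ p q → ∣ p ℚ.- q ∣ ≡ ∣ q ℚ.- p ∣
  ∣-∣-comm p q = trans (sym (ℚ.∣-p∣≡∣p∣ (p ℚ.- q))) (cong ∣_∣ (lemma p q))
    where
    open +-*-Solver
    lemma : ∀ p q → ℚ.- (p ℚ.- q) ≡ q ℚ.- p
    lemma = solve 2 (λ p q → :- (p :- q) := q :- p) refl

  ∣+∣<ε : ∀ p q ε → ∣ p ∣ ℚ.< ½ ℚ.* ε → ∣ q ∣ ℚ.< ½ ℚ.* ε → ∣ p ℚ.+ q ∣ ℚ.< ε
  ∣+∣<ε p q ε p< q< = subst (∣ p ℚ.+ q ∣ ℚ.<_) (half+half ε)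
    (ℚ.≤-<-trans (ℚ.∣p+q∣≤∣p∣+∣q∣ p q) (ℚ.+-mono-< p< q<))

  +-estimate : ∀ a b c d ε → ∣ a ℚ.- c ∣ ℚ.< ½ ℚ.* ε → ∣ b ℚ.- d ∣ ℚ.< ½ ℚ.* ε →
               ∣ (a ℚ.+ b) ℚ.- (c ℚ.+ d) ∣ ℚ.< ε
  +-estimate a b c d ε h₁ h₂ = subst (λ q → ∣ q ∣ ℚ.< ε) (lemma a b c d)
    (∣+∣<ε (a ℚ.- c) (b ℚ.- d) ε h₁ h₂)
    where
    open +-*-Solver
    lemma : ∀ a b c d → (a ℚ.- c) ℚ.+ (b ℚ.- d) ≡ (a ℚ.+ b) ℚ.- (c ℚ.+ d)
    lemma = solve 4 (λ a b c d → (a :- c) :+ (b :- d) := (a :+ b) :- (c :+ d)) refl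

  trans-estimate : ∀ a b c ε → ∣ a ℚ.- b ∣ ℚ.< ½ ℚ.* ε → ∣ b ℚ.- c ∣ ℚ.< ½ ℚ.* ε →
                   ∣ a ℚ.- c ∣ ℚ.< ε
  trans-estimate a b c ε h₁ h₂ = subst (λ q → ∣ q ∣ ℚ.< ε) (lemma a b c)
    (∣+∣<ε (a ℚ.- b) (b ℚ.- c) ε h₁ h₂)
    where
    open +-*-Solver
    lemma : ∀ a b c → (a ℚ.- b) ℚ.+ (b ℚ.- c) ≡ a ℚ.- c
    lemma = solve 3 (λ a b c → (a :- b) :+ (b :- c) := a :- c) refl

  neg-estimate : ∀ a b ε → ∣ a ℚ.- b ∣ ℚ.< ε → ∣ (ℚ.- a) ℚ.- (ℚ.- b) ∣ ℚ.< ε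
  neg-estimate a b ε h = subst (ℚ._< ε)
    (trans (sym (ℚ.∣-p∣≡∣p∣ (a ℚ.- b))) (cong ∣_∣ (lemma a b))) h
    where
    open +-*-Solver
    lemma : ∀ a b → ℚ.- (a ℚ.- b) ≡ (ℚ.- a) ℚ.- (ℚ.- b)
    lemma = solve 2 (λ a b → :- (a :- b) := (:- a) :- (:- b)) refl

  scale : ∀ {a B} u {δ} → ∣ a ∣ ℚ.< B → ∣ u ∣ ℚ.< δ → ∣ a ℚ.* u ∣ ℚ.≤ B ℚ.* δ
  scale {a} {B} u {δ} a<B u<δ = begin
    ∣ a ℚ.* u ∣         ≡⟨ ℚ.∣p*q∣≡∣p∣*∣q∣ a u ⟩
    ∣ a ∣ ℚ.* ∣ u ∣     ≤⟨ ℚ.*-monoʳ-≤-nonNeg ∣ u ∣ {{ℚ.nonNegative (ℚ.0≤∣p∣ u)}} (ℚ.<⇒≤ a<B) ⟩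
    B ℚ.* ∣ u ∣         ≤⟨ ℚ.*-monoˡ-≤-nonNeg B {{ℚ.nonNegative 0≤B}} (ℚ.<⇒≤ u<δ) ⟩
    B ℚ.* δ             ∎
    where
    open ℚ.≤-Reasoning
    0≤B : 0ℚ ℚ.≤ B
    0≤B = ℚ.≤-trans (ℚ.0≤∣p∣ a) (ℚ.<⇒≤ a<B)

  *-estimate : ∀ a b c d B C δ → ∣ a ∣ ℚ.< B → ∣ d ∣ ℚ.< C →
               ∣ a ℚ.- c ∣ ℚ.< δ → ∣ b ℚ.- d ∣ ℚ.< δ →
               ∣ (a ℚ.* b) ℚ.- (c ℚ.* d) ∣ ℚ.≤ (B ℚ.+ C) ℚ.* δ
  *-estimate a b c d B C δ a<B d<C ac bd = begin
    ∣ (a ℚ.* b) ℚ.- (c ℚ.* d) ∣                      ≡⟨ cong ∣_∣ (lemma a b c d) ⟩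
    ∣ a ℚ.* (b ℚ.- d) ℚ.+ d ℚ.* (a ℚ.- c) ∣          ≤⟨ ℚ.∣p+q∣≤∣p∣+∣q∣ (a ℚ.* (b ℚ.- d)) (d ℚ.* (a ℚ.- c)) ⟩
    ∣ a ℚ.* (b ℚ.- d) ∣ ℚ.+ ∣ d ℚ.* (a ℚ.- c) ∣      ≤⟨ ℚ.+-mono-≤ (scale (b ℚ.- d) a<B bd) (scale (a ℚ.- c) d<C ac) ⟩
    B ℚ.* δ ℚ.+ C ℚ.* δ                              ≡⟨ sym (ℚ.*-distribʳ-+ δ B C) ⟩
    (B ℚ.+ C) ℚ.* δ                                  ∎
    where
    open ℚ.≤-Reasoning
    open +-*-Solver
    lemma : ∀ a b c d → (a ℚ.* b) ℚ.- (c ℚ.* d) ≡ a ℚ.* (b ℚ.- d) ℚ.+ d ℚ.* (a ℚ.- c)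
    lemma = solve 4 (λ a b c d → a :* b :- c :* d := a :* (b :- d) :+ d :* (a :- c)) refl

  bounded : ∀ x → ∃ λ B → ∃ λ N → 0ℚ ℚ.< B × (∀ i → N ℕ.≤ i → ∣ seq x i ∣ ℚ.< B)
  bounded x with cauchy x 1ℚ (ℚ.positive⁻¹ 1ℚ)
  ... | N , close = 1ℚ ℚ.+ ∣ seq x N ∣ , N , 0<B , below
    where
    0<B : 0ℚ ℚ.< 1ℚ ℚ.+ ∣ seq x N ∣
    0<B = ℚ.+-mono-<-≤ (ℚ.positive⁻¹ 1ℚ) (ℚ.0≤∣p∣ (seq x N))
    open +-*-Solver
    lemma : ∀ a b → (a ℚ.- b) ℚ.+ b ≡ a
    lemma = solve 2 (λ a b → (a :- b) :+ b := a) refl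
    below : ∀ i → N ℕ.≤ i → ∣ seq x i ∣ ℚ.< 1ℚ ℚ.+ ∣ seq x N ∣
    below i N≤i = subst (λ q → ∣ q ∣ ℚ.< 1ℚ ℚ.+ ∣ seq x N ∣) (lemma (seq x i) (seq x N))
      (ℚ.≤-<-trans (ℚ.∣p+q∣≤∣p∣+∣q∣ (seq x i ℚ.- seq x N) (seq x N))
        (ℚ.+-mono-<-≤ (close i N N≤i ℕ.≤-refl) ℚ.≤-refl))

  halve-bound : ∀ {p K δ ε} → 0ℚ ℚ.< ε → K ℚ.* δ ≡ ½ ℚ.* ε → p ℚ.≤ K ℚ.* δ → p ℚ.< ε
  halve-bound {p} {K} {δ} {ε} 0<ε eq p≤ = ℚ.≤-<-trans (subst (p ℚ.≤_) eq p≤)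
    (subst (½ ℚ.* ε ℚ.<_) (half+half ε)
      (subst (ℚ._< ½ ℚ.* ε ℚ.+ ½ ℚ.* ε) (ℚ.+-identityʳ (½ ℚ.* ε))
        (ℚ.+-mono-≤-< (ℚ.≤-refl {½ ℚ.* ε}) (half ε 0<ε))))

  ⊔ˡ : ∀ {i} m n → m ℕ.⊔ n ℕ.≤ i → m ℕ.≤ i
  ⊔ˡ m n = ℕ.≤-trans (ℕ.m≤m⊔n m n)

  ⊔ʳ : ∀ {i} m n → m ℕ.⊔ n ℕ.≤ i → n ℕ.≤ i
  ⊔ʳ m n = ℕ.≤-trans (ℕ.m≤n⊔m m n)

  *-modulus : ∀ x y ε → 0ℚ ℚ.< ε → ∃ λ δ → 0ℚ ℚ.< δ × ∃ λ M → ∀ i j b c →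
              M ℕ.≤ i → M ℕ.≤ j → ∣ seq x i ℚ.- c ∣ ℚ.< δ → ∣ b ℚ.- seq y j ∣ ℚ.< δ →
              ∣ (seq x i ℚ.* b) ℚ.- (c ℚ.* seq y j) ∣ ℚ.< ε
  *-modulus x y ε 0<ε = go (bounded x) (bounded y)
    where
    go : (∃ λ B → ∃ λ N → 0ℚ ℚ.< B × (∀ i → N ℕ.≤ i → ∣ seq x i ∣ ℚ.< B)) →
         (∃ λ C → ∃ λ N → 0ℚ ℚ.< C × (∀ i → N ℕ.≤ i → ∣ seq y i ∣ ℚ.< C)) →
         ∃ λ δ → 0ℚ ℚ.< δ × ∃ λ M → ∀ i j b c →
         M ℕ.≤ i → M ℕ.≤ j → ∣ seq x i ℚ.- c ∣ ℚ.< δ → ∣ b ℚ.- seq y j ∣ ℚ.< δ →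
         ∣ (seq x i ℚ.* b) ℚ.- (c ℚ.* seq y j) ∣ ℚ.< ε
    go (B , M , 0<B , x<B) (C , N , 0<C , y<C) =
      finish (shrink (B ℚ.+ C) (ℚ.+-mono-< 0<B 0<C) (½ ℚ.* ε) (half ε 0<ε))
      where
      finish : (∃ λ δ → 0ℚ ℚ.< δ × (B ℚ.+ C) ℚ.* δ ≡ ½ ℚ.* ε) → _
      finish (δ , 0<δ , eq) = δ , 0<δ , M ℕ.⊔ N , λ i j b c M≤i M≤j ac bd →
        halve-bound {∣ (seq x i ℚ.* b) ℚ.- (c ℚ.* seq y j) ∣} {B ℚ.+ C} {δ} {ε} 0<ε eq
          (*-estimate (seq x i) b c (seq y j) B C δ
            (x<B i (⊔ˡ M N M≤i)) (y<C j (⊔ʳ M N M≤j)) ac bd)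

abstract

  const-cauchy : ∀ q → IsCauchy (λ _ → q)
  const-cauchy q ε 0<ε = 0 , λ _ _ _ _ → ∣p-p∣<ε q ε 0<ε

  +-cauchy : ∀ x y → IsCauchy (λ i → seq x i ℚ.+ seq y i)
  +-cauchy x y ε 0<ε =
    let M , p = cauchy x (½ ℚ.* ε) (half ε 0<ε)
        N , q = cauchy y (½ ℚ.* ε) (half ε 0<ε)
    in M ℕ.⊔ N , λ i j i≥ j≥ → +-estimate (seq x i) (seq y i) (seq x j) (seq y j) ε
         (p i j (⊔ˡ M N i≥) (⊔ˡ M N j≥)) (q i j (⊔ʳ M N i≥) (⊔ʳ M N j≥))

  neg-cauchy : ∀ x → IsCauchy (λ i → ℚ.- seq x i)
  neg-cauchy x ε 0<ε = let N , p = cauchy x ε 0<ε in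
    N , λ i j i≥ j≥ → neg-estimate (seq x i) (seq x j) ε (p i j i≥ j≥)

  *-cauchy : ∀ x y → IsCauchy (λ i → seq x i ℚ.* seq y i)
  *-cauchy x y ε 0<ε =
    let δ , 0<δ , M , close = *-modulus x y ε 0<ε
        N₁ , p = cauchy x δ 0<δ
        N₂ , q = cauchy y δ 0<δ
        N = N₁ ℕ.⊔ N₂
    in M ℕ.⊔ N , λ i j i≥ j≥ →
         close i j (seq y i) (seq x j) (⊔ˡ M N i≥) (⊔ˡ M N j≥)
           (p i j (⊔ˡ N₁ N₂ (⊔ʳ M N i≥)) (⊔ˡ N₁ N₂ (⊔ʳ M N j≥)))
           (q i j (⊔ʳ N₁ N₂ (⊔ʳ M N i≥)) (⊔ʳ N₁ N₂ (⊔ʳ M N j≥)))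

infixl 6 _+ℝ_ _-ℝ_
infixl 7 _*ℝ_
infix  8 -ℝ_

fromℚ : ℚ → ℝ
fromℚ q = mkℝ (λ _ → q) (const-cauchy q)

0ℝ 1ℝ : ℝ
0ℝ = fromℚ 0ℚ
1ℝ = fromℚ 1ℚ

_+ℝ_ : ℝ → ℝ → ℝ
x +ℝ y = mkℝ (λ i → seq x i ℚ.+ seq y i) (+-cauchy x y)

-ℝ_ : ℝ → ℝ
-ℝ x = mkℝ (λ i → ℚ.- seq x i) (neg-cauchy x)

_-ℝ_ : ℝ → ℝ → ℝ
x -ℝ y = x +ℝ (-ℝ y)

_*ℝ_ : ℝ → ℝ → ℝ
x *ℝ y = mkℝ (λ i → seq x i ℚ.* seq y i) (*-cauchy x y)

private

  pointwise : ∀ {x y} → (∀ i → seq x i ≡ seq y i) → x ≃ y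
  pointwise {x} {y} eq = mk≃ λ ε 0<ε → 0 , λ i _ →
    subst (λ q → ∣ seq x i ℚ.- q ∣ ℚ.< ε) (eq i) (∣p-p∣<ε (seq x i) ε 0<ε)

  ≃-refl : ∀ {x} → x ≃ x
  ≃-refl {x} = pointwise λ _ → refl

  ≃-sym : ∀ {x y} → x ≃ y → y ≃ x
  ≃-sym {x} {y} (mk≃ e) = mk≃ λ ε 0<ε → let N , p = e ε 0<ε in
    N , λ i i≥ → subst (ℚ._< ε) (∣-∣-comm (seq x i) (seq y i)) (p i i≥)

  ≃-trans : ∀ {x y z} → x ≃ y → y ≃ z → x ≃ z
  ≃-trans {x} {y} {z} (mk≃ e) (mk≃ f) = mk≃ λ ε 0<ε →
    let M , p = e (½ ℚ.* ε) (half ε 0<ε)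
        N , q = f (½ ℚ.* ε) (half ε 0<ε)
    in M ℕ.⊔ N , λ i i≥ → trans-estimate (seq x i) (seq y i) (seq z i) ε
         (p i (⊔ˡ M N i≥)) (q i (⊔ʳ M N i≥))

  +ℝ-cong : ∀ {x x′ y y′} → x ≃ x′ → y ≃ y′ → x +ℝ y ≃ x′ +ℝ y′
  +ℝ-cong {x} {x′} {y} {y′} (mk≃ e) (mk≃ f) = mk≃ λ ε 0<ε →
    let M , p = e (½ ℚ.* ε) (half ε 0<ε)
        N , q = f (½ ℚ.* ε) (half ε 0<ε)
    in M ℕ.⊔ N , λ i i≥ → +-estimate (seq x i) (seq y i) (seq x′ i) (seq y′ i) ε
         (p i (⊔ˡ M N i≥)) (q i (⊔ʳ M N i≥))

  -ℝ-cong : ∀ {x x′} → x ≃ x′ → -ℝ x ≃ -ℝ x′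
  -ℝ-cong {x} {x′} (mk≃ e) = mk≃ λ ε 0<ε → let N , p = e ε 0<ε in
    N , λ i i≥ → neg-estimate (seq x i) (seq x′ i) ε (p i i≥)

  *ℝ-cong : ∀ {x x′ y y′} → x ≃ x′ → y ≃ y′ → x *ℝ y ≃ x′ *ℝ y′
  *ℝ-cong {x} {x′} {y} {y′} (mk≃ e) (mk≃ f) = mk≃ λ ε 0<ε →
    let δ , 0<δ , M , close = *-modulus x y′ ε 0<ε
        N₁ , p = e δ 0<δ
        N₂ , q = f δ 0<δ
        N = N₁ ℕ.⊔ N₂
    in M ℕ.⊔ N , λ i i≥ →
         close i i (seq y i) (seq x′ i) (⊔ˡ M N i≥) (⊔ˡ M N i≥)
           (p i (⊔ˡ N₁ N₂ (⊔ʳ M N i≥))) (q i (⊔ʳ N₁ N₂ (⊔ʳ M N i≥)))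

  +ℝ-assoc : ∀ x y z → (x +ℝ y) +ℝ z ≃ x +ℝ (y +ℝ z)
  +ℝ-assoc x y z = pointwise λ i → ℚ.+-assoc (seq x i) (seq y i) (seq z i)

  +ℝ-comm : ∀ x y → x +ℝ y ≃ y +ℝ x
  +ℝ-comm x y = pointwise λ i → ℚ.+-comm (seq x i) (seq y i)

  +ℝ-identityˡ : ∀ x → 0ℝ +ℝ x ≃ x
  +ℝ-identityˡ x = pointwise λ i → ℚ.+-identityˡ (seq x i)

  +ℝ-identityʳ : ∀ x → x +ℝ 0ℝ ≃ x
  +ℝ-identityʳ x = pointwise λ i → ℚ.+-identityʳ (seq x i)

  -ℝ-inverseˡ : ∀ x → (-ℝ x) +ℝ x ≃ 0ℝ
  -ℝ-inverseˡ x = pointwise λ i → ℚ.+-inverseˡ (seq x i)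

  -ℝ-inverseʳ : ∀ x → x +ℝ (-ℝ x) ≃ 0ℝ
  -ℝ-inverseʳ x = pointwise λ i → ℚ.+-inverseʳ (seq x i)

  *ℝ-assoc : ∀ x y z → (x *ℝ y) *ℝ z ≃ x *ℝ (y *ℝ z)
  *ℝ-assoc x y z = pointwise λ i → ℚ.*-assoc (seq x i) (seq y i) (seq z i)

  *ℝ-comm : ∀ x y → x *ℝ y ≃ y *ℝ x
  *ℝ-comm x y = pointwise λ i → ℚ.*-comm (seq x i) (seq y i)

  *ℝ-identityˡ : ∀ x → 1ℝ *ℝ x ≃ x
  *ℝ-identityˡ x = pointwise λ i → ℚ.*-identityˡ (seq x i)

  *ℝ-identityʳ : ∀ x → x *ℝ 1ℝ ≃ x
  *ℝ-identityʳ x = pointwise λ i → ℚ.*-identityʳ (seq x i)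

  *ℝ-distribˡ-+ℝ : ∀ x y z → x *ℝ (y +ℝ z) ≃ (x *ℝ y) +ℝ (x *ℝ z)
  *ℝ-distribˡ-+ℝ x y z = pointwise λ i → ℚ.*-distribˡ-+ (seq x i) (seq y i) (seq z i)

  *ℝ-distribʳ-+ℝ : ∀ x y z → (y +ℝ z) *ℝ x ≃ (y *ℝ x) +ℝ (z *ℝ x)
  *ℝ-distribʳ-+ℝ x y z = pointwise λ i → ℚ.*-distribʳ-+ (seq x i) (seq y i) (seq z i)

ℝ-commutativeRing : CommutativeRing 0ℓ 0ℓ
ℝ-commutativeRing = record
  { Carrier = ℝ
  ; _≈_ = _≃_
  ; _+_ = _+ℝ_
  ; _*_ = _*ℝ_
  ; -_ = -ℝ_
  ; 0# = 0ℝ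
  ; 1# = 1ℝ
  ; isCommutativeRing = record
    { isRing = record
      { +-isAbelianGroup = record
        { isGroup = record
          { isMonoid = record
            { isSemigroup = record
              { isMagma = record
                { isEquivalence = record
                  { refl = ≃-refl
                  ; sym = ≃-sym
                  ; trans = ≃-trans
                  }
                ; ∙-cong = +ℝ-cong
                }
              ; assoc = +ℝ-assoc
              }
            ; identity = +ℝ-identityˡ , +ℝ-identityʳ
            }
          ; inverse = -ℝ-inverseˡ , -ℝ-inverseʳ
          ; ⁻¹-cong = -ℝ-cong
          }
        ; comm = +ℝ-comm
        }
      ; *-cong = *ℝ-cong
      ; *-assoc = *ℝ-assoc
      ; *-identity = *ℝ-identityˡ , *ℝ-identityʳ
      ; distrib = *ℝ-distribˡ-+ℝ , *ℝ-distribʳ-+ℝ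
      }
    ; *-comm = *ℝ-comm
    }
  }

-- Each permutation of Fin (suc n) is determined by the image k of zero
-- and the permutation π that remains once zero and k are removed.
Sym : ∀ n → List (Permutation′ n)
Sym zero    = [ Perm.id ]
Sym (suc n) = concatMap (λ k → map (insert zero k) (Sym n)) (allFin (suc n))

inversions : ∀ {n} → Permutation′ n → ℕ
inversions {n} σ = length (filter
  (λ (i , j) → i Fin.<? j ×-dec (σ ⟨$⟩ʳ j) Fin.<? (σ ⟨$⟩ʳ i))
  (cartesianProduct (allFin n) (allFin n)))

Matrix : ∀ {a} → Set a → ℕ → Set a
Matrix A n = Fin n → Fin n → A

-- The submatrix without rows s, t and columns s, t: once the index s is
-- gone, t has become the index punchOut s≢t.
delete₂ : ∀ {a n} {A : Set a} {s t : Fin n} → s ≢ t → Matrix A n → Matrix A (n ℕ.∸ 2)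
delete₂ {n = 1} {s = zero} {t = zero} s≢t M = contradiction refl s≢t
delete₂ {n = suc (suc n)} {s = s} {t = t} s≢t M i j =
  M (punchIn s (punchIn (punchOut s≢t) i)) (punchIn s (punchIn (punchOut s≢t) j))

module SumsAndDeterminants {c ℓ} (S : RawRing c ℓ) where
  open RawRing S
  open RawSemiringDefinitions rawSemiring using (product; _^_)

  Σ[_] : ∀ {a} {A : Set a} → List A → (A → Carrier) → Carrier
  Σ[ xs ] f = foldr (λ x acc → f x + acc) 0# xs

  identity : ∀ {n} → Matrix Carrier n
  identity i j = if does (i Fin.≟ j) then 1# else 0#

  sgn : ∀ {n} → Permutation′ n → Carrier
  sgn σ = (- 1#) ^ inversions σ

  det : ∀ {n} → Matrix Carrier n → Carrier
  det {n} M = Σ[ Sym n ] λ σ → sgn σ * product (λ k → M k (σ ⟨$⟩ʳ k))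

  per : ∀ {n} → Matrix Carrier n → Carrier
  per {n} M = Σ[ Sym n ] λ σ → product (λ k → M k (σ ⟨$⟩ʳ k))

record Graph (n : ℕ) : Set where
  field
    adj        : Fin n → Fin n → Bool
    adj-sym    : ∀ i j → adj i j ≡ adj j i
    adj-irrefl : ∀ i → adj i i ≡ false

open Graph

degree : ∀ {n} → Graph n → Fin n → ℕ
degree {n} G i = length (filter (λ j → T? (adj G i j)) (allFin n))

-- The requirement s < t picks one orientation of each undirected edge.
record Edge {n} (G : Graph n) : Set where
  constructor mkEdge
  field
    s t      : Fin n
    s<t      : s Fin.< t
    adjacent : T (adj G s t)

  s≢t : s ≢ t
  s≢t = Fin.<⇒≢ s<t

edgeBetween : ∀ {n} (G : Graph n) (s t : Fin n) → List (Edge G)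
edgeBetween G s t with s Fin.<? t ×-dec T? (adj G s t)
... | yes (s<t , adjacent) = [ mkEdge s t s<t adjacent ]
... | no _                 = []

edges : ∀ {n} (G : Graph n) → List (Edge G)
edges {n} G = concatMap (λ s → concatMap (edgeBetween G s) (allFin n)) (allFin n)

infixl 6 _∖_

_∖_ : ∀ {n} (G : Graph n) → Edge G → Graph n
_∖_ {n} G e = record
  { adj        = λ i j → adj G i j ∧ not (joins i j)
  ; adj-sym    = λ i j → cong₂ (λ b c → b ∧ not c) (adj-sym G i j) (joins-sym i j)
  ; adj-irrefl = λ i → cong (_∧ not (joins i i)) (adj-irrefl G i)
  }
  where
  open Edge e
  is : Fin n → Fin n → Bool
  is i j = does (i Fin.≟ j)
  joins : Fin n → Fin n → Bool
  joins i j = (is i s ∧ is j t) ∨ (is i t ∧ is j s)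
  joins-sym : ∀ i j → joins i j ≡ joins j i
  joins-sym i j = trans (∨-comm (is i s ∧ is j t) (is i t ∧ is j s))
    (cong₂ _∨_ (∧-comm (is i t) (is j s)) (∧-comm (is i s) (is j t)))

-- Polynomials in one indeterminate, as lists of coefficients starting
-- with the constant one. Trailing zeros are allowed, so equality
-- compares coefficients rather than lists.

module Polynomials {c ℓ} (R : CommutativeRing c ℓ) where
  open CommutativeRing R
  open RawMonoidDefinitions +-rawMonoid using () renaming (_×_ to _·_)

  infix  4 _≈ₚ_
  infixl 6 _+ₚ_ _-ₚ_
  infixl 7 _*ₚ_
  infix  8 -ₚ_

  Polynomial : Set c
  Polynomial = List Carrier

  coeff : Polynomial → ℕ → Carrier
  coeff []      _       = 0#
  coeff (a ∷ p) zero    = a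
  coeff (a ∷ p) (suc k) = coeff p k

  record _≈ₚ_ (p q : Polynomial) : Set ℓ where
    constructor mk≈ₚ
    field
      coeff-≈ : ∀ k → coeff p k ≈ coeff q k

  0ₚ 1ₚ X : Polynomial
  0ₚ = []
  1ₚ = 1# ∷ []
  X  = 0# ∷ 1# ∷ []

  const : Carrier → Polynomial
  const a = a ∷ []

  _+ₚ_ : Polynomial → Polynomial → Polynomial
  []      +ₚ q       = q
  (a ∷ p) +ₚ []      = a ∷ p
  (a ∷ p) +ₚ (b ∷ q) = (a + b) ∷ (p +ₚ q)

  -ₚ_ : Polynomial → Polynomial
  -ₚ_ = map (-_)

  _-ₚ_ : Polynomial → Polynomial → Polynomial
  p -ₚ q = p +ₚ (-ₚ q)

  _*ₚ_ : Polynomial → Polynomial → Polynomial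
  []      *ₚ q = []
  (a ∷ p) *ₚ q = map (a *_) q +ₚ (0# ∷ (p *ₚ q))

  weighted : ℕ → Polynomial → Polynomial
  weighted k []      = []
  weighted k (a ∷ p) = (k · a) ∷ weighted (suc k) p

  deriv : Polynomial → Polynomial
  deriv []      = []
  deriv (_ ∷ p) = weighted 1 p

  polynomialRawRing : RawRing c ℓ
  polynomialRawRing = record
    { Carrier = Polynomial
    ; _≈_ = _≈ₚ_
    ; _+_ = _+ₚ_
    ; _*_ = _*ₚ_
    ; -_ = -ₚ_
    ; 0# = 0ₚ
    ; 1# = 1ₚ
    }

module GraphPolynomials {c ℓ} (R : CommutativeRing c ℓ) where
  open CommutativeRing R
  open RawMonoidDefinitions +-rawMonoid using () renaming (_×_ to _·_)
  open Polynomials R public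
  open SumsAndDeterminants polynomialRawRing public

  fromℕ : ℕ → Carrier
  fromℕ k = k · 1#

  degreeMatrix : ∀ {n} → Graph n → Matrix Carrier n
  degreeMatrix G i j = if does (i Fin.≟ j) then fromℕ (degree G i) else 0#

  adjacencyMatrix : ∀ {n} → Graph n → Matrix Carrier n
  adjacencyMatrix G i j = if adj G i j then 1# else 0#

  -- x Iₙ - β D - γ A
  matrix : Carrier → Carrier → ∀ {n} → Graph n → Matrix Polynomial n
  matrix β γ G i j =
    X *ₚ identity i j -ₚ const (β * degreeMatrix G i j) -ₚ const (γ * adjacencyMatrix G i j)

  τ₁ : Carrier → Carrier → ∀ {n} → Graph n → Polynomial
  τ₁ β γ G = det (matrix β γ G)

  τ₂ : Carrier → Carrier → ∀ {n} → Graph n → Polynomial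
  τ₂ β γ G = per (matrix β γ G)

open GraphPolynomials ℝ-commutativeRing public

{-# OPTIONS --safe #-}
module Submission where

-- Put M = x I − β D − γ A. Deleting an edge st adds β e_s + γ e_t to row s of
-- M and β e_t + γ e_s to row t, so multilinearity splits det M(G − e) into
-- det M, two terms with one row replaced and one term with both rows replaced;
-- the latter is (β² − γ²) times the minor of M without s and t. Since
-- Σ_{j ~ i} (β e_i + γ e_j) = x e_i − M_i, the terms with one row replaced sum
-- over all edges to x Σ_i det M[i ← e_i] − n det M, and the sum in it is the
-- derivative of det M. The permanent differs only in the sign of the terms
-- with two rows replaced.

open import Defs
  using (module SumsAndDeterminants; module Polynomials; module GraphPolynomials; Matrix; delete₂; Sym; inversions;
         Graph; degree; Edge; edges; edgeBetween; _∖_)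
open import Algebra.Bundles using (CommutativeRing; RawRing)
import Algebra.Definitions.RawSemiring as RawSemiringDefinitions
import Algebra.Properties.CommutativeMonoid.Mult
import Algebra.Properties.CommutativeMonoid.Sum
import Algebra.Properties.CommutativeSemigroup
import Algebra.Properties.Ring
import Algebra.Properties.Semiring.Exp
import Algebra.Properties.Semiring.Mult
import Algebra.Properties.Semiring.Sum
open import Data.Bool.Base using (Bool; true; false; if_then_else_; not; _∧_; _∨_)
open import Data.Bool.Properties using (T?; ∨-identityʳ)
open import Data.Fin.Base as Fin using (Fin; zero; suc; toℕ; punchIn; punchOut; pinch)
open import Data.Fin.Permutation as Perm using (Permutation′; insert; _⟨$⟩ʳ_)
import Data.Fin.Properties as Fin
open import Data.List.Base
  using (List; []; _∷_; _++_; map; concatMap; filter; length; tabulate; allFin; cartesianProduct)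
import Data.List.Properties as List
open import Data.Nat.Base as ℕ using (ℕ; zero; suc)
import Data.Nat.Properties as ℕ
open import Data.Product.Base using (_×_; _,_)
open import Data.Vec.Functional as Vector using (Vector; updateAt; removeAt)
import Data.Vec.Functional.Properties as Vector
open import Function.Base as Function using (_∘_)
open import Function.Bundles using (mk⇔)
open import Relation.Binary.Bundles using (Setoid)
open import Relation.Binary.Definitions using (tri<; tri≈; tri>)
open import Relation.Binary.PropositionalEquality as ≡ using (_≡_; _≢_)
import Relation.Binary.Reasoning.Setoid as SetoidReasoning
open import Relation.Nullary using (Dec; ¬_; does; yes; no; contradiction)
open import Relation.Nullary.Decidable using (does-⇔; dec-true; dec-false; _×-dec_)

-- Polynomial rings

module PolynomialRing {c ℓ} (R : CommutativeRing c ℓ) where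
  open CommutativeRing R
  open Polynomials R
  open _≈ₚ_
  open Algebra.Properties.Ring ring using (-0#≈0#)
  open Algebra.Properties.CommutativeSemigroup +-commutativeSemigroup
    using (interchange)
  open Algebra.Properties.Semiring.Mult semiring using (×-congʳ; ×-comm-*) renaming (_×_ to _·_)
  open Algebra.Properties.CommutativeMonoid.Mult +-commutativeMonoid using (×-distrib-+)

  ≈ₚ-refl : ∀ {p} → p ≈ₚ p
  ≈ₚ-refl = mk≈ₚ λ _ → refl

  ≈ₚ-sym : ∀ {p q} → p ≈ₚ q → q ≈ₚ p
  ≈ₚ-sym e = mk≈ₚ λ k → sym (coeff-≈ e k)

  ≈ₚ-trans : ∀ {p q r} → p ≈ₚ q → q ≈ₚ r → p ≈ₚ r
  ≈ₚ-trans e f = mk≈ₚ λ k → trans (coeff-≈ e k) (coeff-≈ f k)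

  ≈ₚ-setoid : Setoid c ℓ
  ≈ₚ-setoid = record
    { Carrier = Polynomial
    ; _≈_ = _≈ₚ_
    ; isEquivalence = record { refl = ≈ₚ-refl ; sym = ≈ₚ-sym ; trans = ≈ₚ-trans }
    }

  infixr 5 _∷-cong_

  _∷-cong_ : ∀ {a b p q} → a ≈ b → p ≈ₚ q → a ∷ p ≈ₚ b ∷ q
  a≈b ∷-cong p≈q = mk≈ₚ λ { zero → a≈b ; (suc k) → coeff-≈ p≈q k }

  coeff-+ : ∀ p q k → coeff (p +ₚ q) k ≈ coeff p k + coeff q k
  coeff-+ []      q       k       = sym (+-identityˡ _)
  coeff-+ (a ∷ p) []      k       = sym (+-identityʳ _)
  coeff-+ (a ∷ p) (b ∷ q) zero    = refl
  coeff-+ (a ∷ p) (b ∷ q) (suc k) = coeff-+ p q k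

  coeff-neg : ∀ p k → coeff (-ₚ p) k ≈ - coeff p k
  coeff-neg []      k       = sym -0#≈0#
  coeff-neg (a ∷ p) zero    = refl
  coeff-neg (a ∷ p) (suc k) = coeff-neg p k

  coeff-scale : ∀ a p k → coeff (map (a *_) p) k ≈ a * coeff p k
  coeff-scale a []      k       = sym (zeroʳ a)
  coeff-scale a (b ∷ p) zero    = refl
  coeff-scale a (b ∷ p) (suc k) = coeff-scale a p k

  +ₚ-cong : ∀ {p p′ q q′} → p ≈ₚ p′ → q ≈ₚ q′ → p +ₚ q ≈ₚ p′ +ₚ q′
  +ₚ-cong {p} {p′} {q} {q′} e f = mk≈ₚ λ k → trans (coeff-+ p q k)
    (trans (+-cong (coeff-≈ e k) (coeff-≈ f k)) (sym (coeff-+ p′ q′ k)))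

  -ₚ-cong : ∀ {p p′} → p ≈ₚ p′ → -ₚ p ≈ₚ -ₚ p′
  -ₚ-cong {p} {p′} e = mk≈ₚ λ k → trans (coeff-neg p k)
    (trans (-‿cong (coeff-≈ e k)) (sym (coeff-neg p′ k)))

  +ₚ-assoc : ∀ p q r → (p +ₚ q) +ₚ r ≈ₚ p +ₚ (q +ₚ r)
  +ₚ-assoc []      q       r       = ≈ₚ-refl
  +ₚ-assoc (a ∷ p) []      r       = ≈ₚ-refl
  +ₚ-assoc (a ∷ p) (b ∷ q) []      = ≈ₚ-refl
  +ₚ-assoc (a ∷ p) (b ∷ q) (c ∷ r) = +-assoc a b c ∷-cong +ₚ-assoc p q r

  +ₚ-comm : ∀ p q → p +ₚ q ≈ₚ q +ₚ p
  +ₚ-comm p q = mk≈ₚ λ k → trans (coeff-+ p q k)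
    (trans (+-comm _ _) (sym (coeff-+ q p k)))

  +ₚ-identityʳ : ∀ p → p +ₚ 0ₚ ≈ₚ p
  +ₚ-identityʳ p = +ₚ-comm p 0ₚ

  -ₚ-inverseˡ : ∀ p → -ₚ p +ₚ p ≈ₚ 0ₚ
  -ₚ-inverseˡ p = mk≈ₚ λ k → trans (coeff-+ (-ₚ p) p k)
    (trans (+-congʳ (coeff-neg p k)) (-‿inverseˡ _))

  +ₚ-interchange : ∀ p q r s → (p +ₚ q) +ₚ (r +ₚ s) ≈ₚ (p +ₚ r) +ₚ (q +ₚ s)
  +ₚ-interchange p q r s = mk≈ₚ λ k → trans (expand p q r s k)
    (trans (interchange _ _ _ _) (sym (expand p r q s k)))
    where
    expand : ∀ p q r s k → coeff ((p +ₚ q) +ₚ (r +ₚ s)) k ≈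
             (coeff p k + coeff q k) + (coeff r k + coeff s k)
    expand p q r s k = trans (coeff-+ (p +ₚ q) (r +ₚ s) k) (+-cong (coeff-+ p q k) (coeff-+ r s k))

  scale-cong : ∀ {a b p q} → a ≈ b → p ≈ₚ q → map (a *_) p ≈ₚ map (b *_) q
  scale-cong {a} {b} {p} {q} e f = mk≈ₚ λ k → trans (coeff-scale a p k)
    (trans (*-cong e (coeff-≈ f k)) (sym (coeff-scale b q k)))

  scale-+ₚ : ∀ a p q → map (a *_) (p +ₚ q) ≈ₚ map (a *_) p +ₚ map (a *_) q
  scale-+ₚ a []      q       = ≈ₚ-refl
  scale-+ₚ a (b ∷ p) []      = ≈ₚ-refl
  scale-+ₚ a (b ∷ p) (c ∷ q) = distribˡ a b c ∷-cong scale-+ₚ a p q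

  +-scale : ∀ a b p → map ((a + b) *_) p ≈ₚ map (a *_) p +ₚ map (b *_) p
  +-scale a b []      = ≈ₚ-refl
  +-scale a b (c ∷ p) = distribʳ c a b ∷-cong +-scale a b p

  *-scale : ∀ a b p → map ((a * b) *_) p ≈ₚ map (a *_) (map (b *_) p)
  *-scale a b []      = ≈ₚ-refl
  *-scale a b (c ∷ p) = *-assoc a b c ∷-cong *-scale a b p

  1-scale : ∀ p → map (1# *_) p ≈ₚ p
  1-scale []      = ≈ₚ-refl
  1-scale (a ∷ p) = *-identityˡ a ∷-cong 1-scale p

  0-scale : ∀ p → map (0# *_) p ≈ₚ 0ₚ
  0-scale p = mk≈ₚ λ k → trans (coeff-scale 0# p k) (zeroˡ _)

  0∷0≈0 : 0# ∷ 0ₚ ≈ₚ 0ₚ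
  0∷0≈0 = mk≈ₚ λ { zero → refl ; (suc _) → refl }

  open SetoidReasoning ≈ₚ-setoid

  0∷-+ₚ : ∀ p q → 0# ∷ (p +ₚ q) ≈ₚ (0# ∷ p) +ₚ (0# ∷ q)
  0∷-+ₚ p q = sym (+-identityˡ 0#) ∷-cong ≈ₚ-refl

  scale-0∷ : ∀ a p → map (a *_) (0# ∷ p) ≈ₚ 0# ∷ map (a *_) p
  scale-0∷ a p = zeroʳ a ∷-cong ≈ₚ-refl

  0∷-*ₚ : ∀ p q → (0# ∷ p) *ₚ q ≈ₚ 0# ∷ (p *ₚ q)
  0∷-*ₚ p q = +ₚ-cong (0-scale q) ≈ₚ-refl

  *ₚ-congˡ : ∀ p {q q′} → q ≈ₚ q′ → p *ₚ q ≈ₚ p *ₚ q′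
  *ₚ-congˡ []      e = ≈ₚ-refl
  *ₚ-congˡ (a ∷ p) e = +ₚ-cong (scale-cong refl e) (refl ∷-cong *ₚ-congˡ p e)

  *ₚ-zeroʳ : ∀ p → p *ₚ 0ₚ ≈ₚ 0ₚ
  *ₚ-zeroʳ []      = ≈ₚ-refl
  *ₚ-zeroʳ (a ∷ p) = ≈ₚ-trans (refl ∷-cong *ₚ-zeroʳ p) 0∷0≈0

  *ₚ-∷ : ∀ p b q → p *ₚ (b ∷ q) ≈ₚ map (b *_) p +ₚ (0# ∷ (p *ₚ q))
  *ₚ-∷ []      b q = ≈ₚ-sym 0∷0≈0
  *ₚ-∷ (a ∷ p) b q = +-cong (*-comm a b) refl ∷-cong (begin
    map (a *_) q +ₚ p *ₚ (b ∷ q)                      ≈⟨ +ₚ-cong ≈ₚ-refl (*ₚ-∷ p b q) ⟩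
    map (a *_) q +ₚ (map (b *_) p +ₚ (0# ∷ (p *ₚ q))) ≈⟨ +ₚ-assoc (map (a *_) q) (map (b *_) p) _ ⟨
    (map (a *_) q +ₚ map (b *_) p) +ₚ (0# ∷ (p *ₚ q)) ≈⟨ +ₚ-cong (+ₚ-comm (map (a *_) q) (map (b *_) p)) ≈ₚ-refl ⟩
    (map (b *_) p +ₚ map (a *_) q) +ₚ (0# ∷ (p *ₚ q)) ≈⟨ +ₚ-assoc (map (b *_) p) (map (a *_) q) _ ⟩
    map (b *_) p +ₚ (map (a *_) q +ₚ (0# ∷ (p *ₚ q))) ∎)

  *ₚ-comm : ∀ p q → p *ₚ q ≈ₚ q *ₚ p
  *ₚ-comm []      q = ≈ₚ-sym (*ₚ-zeroʳ q)
  *ₚ-comm (a ∷ p) q = begin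
    map (a *_) q +ₚ (0# ∷ (p *ₚ q)) ≈⟨ +ₚ-cong ≈ₚ-refl (refl ∷-cong *ₚ-comm p q) ⟩
    map (a *_) q +ₚ (0# ∷ (q *ₚ p)) ≈⟨ *ₚ-∷ q a p ⟨
    q *ₚ (a ∷ p)                    ∎

  *ₚ-cong : ∀ {p p′ q q′} → p ≈ₚ p′ → q ≈ₚ q′ → p *ₚ q ≈ₚ p′ *ₚ q′
  *ₚ-cong {p} {p′} {q} {q′} e f = begin
    p *ₚ q   ≈⟨ *ₚ-congˡ p f ⟩
    p *ₚ q′  ≈⟨ *ₚ-comm p q′ ⟩
    q′ *ₚ p  ≈⟨ *ₚ-congˡ q′ e ⟩
    q′ *ₚ p′ ≈⟨ *ₚ-comm q′ p′ ⟩
    p′ *ₚ q′ ∎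

  *ₚ-distribˡ : ∀ p q r → p *ₚ (q +ₚ r) ≈ₚ p *ₚ q +ₚ p *ₚ r
  *ₚ-distribˡ []      q r = ≈ₚ-refl
  *ₚ-distribˡ (a ∷ p) q r = begin
    map (a *_) (q +ₚ r) +ₚ (0# ∷ (p *ₚ (q +ₚ r)))
      ≈⟨ +ₚ-cong (scale-+ₚ a q r) (≈ₚ-trans (refl ∷-cong *ₚ-distribˡ p q r) (0∷-+ₚ (p *ₚ q) (p *ₚ r))) ⟩
    (map (a *_) q +ₚ map (a *_) r) +ₚ ((0# ∷ (p *ₚ q)) +ₚ (0# ∷ (p *ₚ r)))
      ≈⟨ +ₚ-interchange (map (a *_) q) (map (a *_) r) _ _ ⟩
    (a ∷ p) *ₚ q +ₚ (a ∷ p) *ₚ r ∎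

  *ₚ-distribʳ : ∀ p q r → (q +ₚ r) *ₚ p ≈ₚ q *ₚ p +ₚ r *ₚ p
  *ₚ-distribʳ p q r = begin
    (q +ₚ r) *ₚ p    ≈⟨ *ₚ-comm (q +ₚ r) p ⟩
    p *ₚ (q +ₚ r)    ≈⟨ *ₚ-distribˡ p q r ⟩
    p *ₚ q +ₚ p *ₚ r ≈⟨ +ₚ-cong (*ₚ-comm p q) (*ₚ-comm p r) ⟩
    q *ₚ p +ₚ r *ₚ p ∎

  scale-*ₚ : ∀ a p q → map (a *_) p *ₚ q ≈ₚ map (a *_) (p *ₚ q)
  scale-*ₚ a []      q = ≈ₚ-refl
  scale-*ₚ a (b ∷ p) q = begin
    map ((a * b) *_) q +ₚ (0# ∷ (map (a *_) p *ₚ q))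
      ≈⟨ +ₚ-cong (*-scale a b q) (≈ₚ-trans (refl ∷-cong scale-*ₚ a p q) (≈ₚ-sym (scale-0∷ a (p *ₚ q)))) ⟩
    map (a *_) (map (b *_) q) +ₚ map (a *_) (0# ∷ (p *ₚ q))
      ≈⟨ scale-+ₚ a (map (b *_) q) _ ⟨
    map (a *_) ((b ∷ p) *ₚ q) ∎

  *ₚ-assoc : ∀ p q r → (p *ₚ q) *ₚ r ≈ₚ p *ₚ (q *ₚ r)
  *ₚ-assoc []      q r = ≈ₚ-refl
  *ₚ-assoc (a ∷ p) q r = begin
    (map (a *_) q +ₚ (0# ∷ (p *ₚ q))) *ₚ r
      ≈⟨ *ₚ-distribʳ r (map (a *_) q) _ ⟩
    map (a *_) q *ₚ r +ₚ (0# ∷ (p *ₚ q)) *ₚ r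
      ≈⟨ +ₚ-cong (scale-*ₚ a q r) (≈ₚ-trans (0∷-*ₚ (p *ₚ q) r) (refl ∷-cong *ₚ-assoc p q r)) ⟩
    (a ∷ p) *ₚ (q *ₚ r) ∎

  const-*ₚ : ∀ a p → const a *ₚ p ≈ₚ map (a *_) p
  const-*ₚ a p = ≈ₚ-trans (+ₚ-cong ≈ₚ-refl 0∷0≈0) (+ₚ-identityʳ (map (a *_) p))

  *ₚ-identityˡ : ∀ p → 1ₚ *ₚ p ≈ₚ p
  *ₚ-identityˡ p = ≈ₚ-trans (const-*ₚ 1# p) (1-scale p)

  polynomialRing : CommutativeRing c ℓ
  polynomialRing = record
    { Carrier = Polynomial
    ; _≈_ = _≈ₚ_
    ; _+_ = _+ₚ_
    ; _*_ = _*ₚ_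
    ; -_ = -ₚ_
    ; 0# = 0ₚ
    ; 1# = 1ₚ
    ; isCommutativeRing = record
      { isRing = record
        { +-isAbelianGroup = record
          { isGroup = record
            { isMonoid = record
              { isSemigroup = record
                { isMagma = record
                  { isEquivalence = Setoid.isEquivalence ≈ₚ-setoid
                  ; ∙-cong = +ₚ-cong
                  }
                ; assoc = +ₚ-assoc
                }
              ; identity = (λ _ → ≈ₚ-refl) , +ₚ-identityʳ
              }
            ; inverse = -ₚ-inverseˡ , λ p → ≈ₚ-trans (+ₚ-comm p (-ₚ p)) (-ₚ-inverseˡ p)
            ; ⁻¹-cong = -ₚ-cong
            }
          ; comm = +ₚ-comm
          }
        ; *-cong = *ₚ-cong
        ; *-assoc = *ₚ-assoc
        ; *-identity = *ₚ-identityˡ , λ p → ≈ₚ-trans (*ₚ-comm p 1ₚ) (*ₚ-identityˡ p)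
        ; distrib = *ₚ-distribˡ , *ₚ-distribʳ
        }
      ; *-comm = *ₚ-comm
      }
    }

  ×-zeroʳ : ∀ m → m · 0# ≈ 0#
  ×-zeroʳ zero    = refl
  ×-zeroʳ (suc m) = trans (+-identityˡ _) (×-zeroʳ m)

  coeff-weighted : ∀ n p k → coeff (weighted n p) k ≈ (k ℕ.+ n) · coeff p k
  coeff-weighted n []      k       = sym (×-zeroʳ (k ℕ.+ n))
  coeff-weighted n (a ∷ p) zero    = refl
  coeff-weighted n (a ∷ p) (suc k) =
    trans (coeff-weighted (suc n) p k) (reflexive (≡.cong (_· coeff p k) (ℕ.+-suc k n)))

  coeff-deriv : ∀ p k → coeff (deriv p) k ≈ suc k · coeff p (suc k)
  coeff-deriv []      k = sym (×-zeroʳ (suc k))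
  coeff-deriv (a ∷ p) k =
    trans (coeff-weighted 1 p k) (reflexive (≡.cong (_· coeff p k) (ℕ.+-comm k 1)))

  deriv-cong : ∀ {p q} → p ≈ₚ q → deriv p ≈ₚ deriv q
  deriv-cong {p} {q} e = mk≈ₚ λ k → trans (coeff-deriv p k)
    (trans (×-congʳ (suc k) (coeff-≈ e (suc k))) (sym (coeff-deriv q k)))

  deriv-+ₚ : ∀ p q → deriv (p +ₚ q) ≈ₚ deriv p +ₚ deriv q
  deriv-+ₚ p q = mk≈ₚ λ k → trans (coeff-deriv (p +ₚ q) k)
    (trans (×-congʳ (suc k) (coeff-+ p q (suc k)))
    (trans (×-distrib-+ _ _ (suc k))
    (trans (+-cong (sym (coeff-deriv p k)) (sym (coeff-deriv q k)))
           (sym (coeff-+ (deriv p) (deriv q) k)))))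

  deriv-∷ : ∀ a p → deriv (a ∷ p) ≈ₚ p +ₚ (0# ∷ deriv p)
  deriv-∷ a p = mk≈ₚ λ k → trans (coeff-deriv (a ∷ p) k)
    (sym (trans (coeff-+ p (0# ∷ deriv p) k) (+-congˡ (shifted k))))
    where
    shifted : ∀ k → coeff (0# ∷ deriv p) k ≈ k · coeff p k
    shifted zero    = refl
    shifted (suc k) = coeff-deriv p k

  deriv-scale : ∀ a p → deriv (map (a *_) p) ≈ₚ map (a *_) (deriv p)
  deriv-scale a p = mk≈ₚ λ k → trans (coeff-deriv (map (a *_) p) k)
    (trans (×-congʳ (suc k) (coeff-scale a p (suc k)))
    (trans (sym (×-comm-* (suc k) a _))
    (trans (*-congˡ (sym (coeff-deriv p k))) (sym (coeff-scale a (deriv p) k)))))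

  deriv-*ₚ : ∀ p q → deriv (p *ₚ q) ≈ₚ deriv p *ₚ q +ₚ p *ₚ deriv q
  deriv-*ₚ []      q = ≈ₚ-refl
  deriv-*ₚ (a ∷ p) q = begin
    deriv (aq +ₚ (0# ∷ (p *ₚ q)))
      ≈⟨ deriv-+ₚ aq (0# ∷ (p *ₚ q)) ⟩
    deriv aq +ₚ deriv (0# ∷ (p *ₚ q))
      ≈⟨ +ₚ-cong (deriv-scale a q) (deriv-∷ 0# (p *ₚ q)) ⟩
    aq′ +ₚ (p *ₚ q +ₚ (0# ∷ deriv (p *ₚ q)))
      ≈⟨ +ₚ-cong {aq′} ≈ₚ-refl (+ₚ-cong {p *ₚ q} ≈ₚ-refl
           (≈ₚ-trans (refl ∷-cong deriv-*ₚ p q) (0∷-+ₚ (deriv p *ₚ q) (p *ₚ deriv q)))) ⟩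
    aq′ +ₚ (p *ₚ q +ₚ ((0# ∷ (deriv p *ₚ q)) +ₚ (0# ∷ (p *ₚ deriv q))))
      ≈⟨ +ₚ-cong {aq′} ≈ₚ-refl (+ₚ-assoc (p *ₚ q) _ _) ⟨
    aq′ +ₚ ((p *ₚ q +ₚ (0# ∷ (deriv p *ₚ q))) +ₚ (0# ∷ (p *ₚ deriv q)))
      ≈⟨ P.x∙yz≈y∙xz aq′ (p *ₚ q +ₚ (0# ∷ (deriv p *ₚ q))) _ ⟩
    (p *ₚ q +ₚ (0# ∷ (deriv p *ₚ q))) +ₚ (a ∷ p) *ₚ deriv q
      ≈⟨ +ₚ-cong (+ₚ-cong {p *ₚ q} ≈ₚ-refl (0∷-*ₚ (deriv p) q)) ≈ₚ-refl ⟨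
    (p *ₚ q +ₚ (0# ∷ deriv p) *ₚ q) +ₚ (a ∷ p) *ₚ deriv q
      ≈⟨ +ₚ-cong (*ₚ-distribʳ q p (0# ∷ deriv p)) ≈ₚ-refl ⟨
    (p +ₚ (0# ∷ deriv p)) *ₚ q +ₚ (a ∷ p) *ₚ deriv q
      ≈⟨ +ₚ-cong (*ₚ-cong (deriv-∷ a p) (≈ₚ-refl {q})) ≈ₚ-refl ⟨
    deriv (a ∷ p) *ₚ q +ₚ (a ∷ p) *ₚ deriv q ∎
    where
    aq  = map (a *_) q
    aq′ = map (a *_) (deriv q)
    module P = Algebra.Properties.CommutativeSemigroup (CommutativeRing.+-commutativeSemigroup polynomialRing)

-- Minors and row replacement

punchIn-punchIn-pinch : ∀ {n} (j : Fin (suc (suc n))) (k : Fin (suc n)) →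
                        punchIn (punchIn j k) (pinch k j) ≡ j
punchIn-punchIn-pinch         zero    k       = ≡.refl
punchIn-punchIn-pinch         (suc j) zero    = ≡.refl
punchIn-punchIn-pinch {suc n} (suc j) (suc k) = ≡.cong suc (punchIn-punchIn-pinch j k)

-- Deleting the j-th and then the k-th point deletes the pair of points j
-- and punchIn j k, which may be deleted in the opposite order as well.
punchIn-comm : ∀ {n} (j : Fin (suc (suc n))) (k : Fin (suc n)) x →
               punchIn (punchIn j k) (punchIn (pinch k j) x) ≡ punchIn j (punchIn k x)
punchIn-comm         zero    k       x       = ≡.refl
punchIn-comm         (suc j) zero    x       = ≡.refl
punchIn-comm {suc n} (suc j) (suc k) zero    = ≡.refl
punchIn-comm {suc n} (suc j) (suc k) (suc x) = ≡.cong suc (punchIn-comm j k x)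

removeAt-updateAt : ∀ {a} {A : Set a} {n} (xs : Vector A (suc n)) i t f →
                    ∀ j → updateAt xs (punchIn i t) f (punchIn i j) ≡ updateAt (removeAt xs i) t f j
removeAt-updateAt xs zero    t       f j       = ≡.refl
removeAt-updateAt xs (suc i) zero    f zero    = ≡.refl
removeAt-updateAt xs (suc i) zero    f (suc j) = ≡.refl
removeAt-updateAt xs (suc i) (suc t) f zero    = ≡.refl
removeAt-updateAt {n = suc n} xs (suc i) (suc t) f (suc j) = removeAt-updateAt (Vector.tail xs) i t f j

minor : ∀ {a} {A : Set a} {n} → Fin (suc n) → Fin (suc n) → Matrix A (suc n) → Matrix A n
minor i j M a b = M (punchIn i a) (punchIn j b)

infixl 7 _[_]≔_

_[_]≔_ : ∀ {a} {A : Set a} {n} → Matrix A n → Fin n → Vector A n → Matrix A n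
M [ i ]≔ u = updateAt M i (Function.const u)

module _ {a} {A : Set a} where

  ≔-row : ∀ {n} (M : Matrix A n) i u → (M [ i ]≔ u) i ≡ u
  ≔-row M i u = Vector.updateAt-updates i M

  ≔-other : ∀ {n} (M : Matrix A n) {i j} u → j ≢ i → (M [ i ]≔ u) j ≡ M j
  ≔-other M {i} {j} u = Vector.updateAt-minimal j i M

  minor-≔ : ∀ {n} i j t (M : Matrix A (suc n)) u k l →
            minor i j (M [ punchIn i t ]≔ u) k l ≡ (minor i j M [ t ]≔ (u ∘ punchIn j)) k l
  minor-≔ i j t M u k l = ≡.trans
    (≡.cong-app (removeAt-updateAt M i t (Function.const u) k) (punchIn j l))
    (≡.cong-app (Vector.map-updateAt {f = _∘ punchIn j} {g = Function.const u} {h = Function.const (u ∘ punchIn j)}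
      (λ _ → ≡.refl) (removeAt M i) t k) l)

-- Inversions

open Algebra.Properties.CommutativeMonoid.Sum ℕ.+-0-commutativeMonoid using () renaming (sum to sumℕ)

module _ where
  open Algebra.Properties.CommutativeMonoid.Sum ℕ.+-0-commutativeMonoid
    using (sum-replicate-zero; sum-permute; sum-cong-≗)
  open ≡.≡-Reasoning

  ⟦_⟧ : Bool → ℕ
  ⟦ b ⟧ = if b then 1 else 0

  length-filter-tabulate : ∀ {a p} {A : Set a} {P : A → Set p} (P? : ∀ x → Dec (P x)) {n} (f : Fin n → A) →
                           length (filter P? (tabulate f)) ≡ sumℕ (λ i → ⟦ does (P? (f i)) ⟧)
  length-filter-tabulate P? {zero}  f = ≡.refl
  length-filter-tabulate P? {suc n} f with P? (f zero)
  ... | yes _ = ≡.cong suc (length-filter-tabulate P? (f ∘ suc))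
  ... | no  _ = length-filter-tabulate P? (f ∘ suc)

  length-filter-× : ∀ {a b p} {A : Set a} {B : Set b} {P : A × B → Set p} (P? : ∀ x → Dec (P x))
                    {m n} (f : Fin m → A) (g : Fin n → B) →
                    length (filter P? (cartesianProduct (tabulate f) (tabulate g))) ≡
                    sumℕ (λ i → sumℕ (λ j → ⟦ does (P? (f i , g j)) ⟧))
  length-filter-× P? {zero}  f g = ≡.refl
  length-filter-× P? {suc m} f g = begin
    length (filter P? (row ++ rest))               ≡⟨ ≡.cong length (List.filter-++ P? row rest) ⟩
    length (filter P? row ++ filter P? rest)       ≡⟨ List.length-++ (filter P? row) ⟩
    length (filter P? row) ℕ.+ length (filter P? rest)
      ≡⟨ ≡.cong₂ ℕ._+_
           (≡.trans (≡.cong (length ∘ filter P?) (List.map-tabulate g (f zero ,_)))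
                    (length-filter-tabulate P? (λ j → f zero , g j)))
           (length-filter-× P? (f ∘ suc) g) ⟩
    sumℕ (λ i → sumℕ (λ j → ⟦ does (P? (f i , g j)) ⟧)) ∎
    where
    row  = map (f zero ,_) (tabulate g)
    rest = cartesianProduct (tabulate (f ∘ suc)) (tabulate g)

  inversions-sum : ∀ {n} (σ : Permutation′ n) → inversions σ ≡
    sumℕ (λ i → sumℕ (λ j → ⟦ does (i Fin.<? j ×-dec (σ ⟨$⟩ʳ j) Fin.<? (σ ⟨$⟩ʳ i)) ⟧))
  inversions-sum σ = length-filter-×
    (λ (i , j) → i Fin.<? j ×-dec (σ ⟨$⟩ʳ j) Fin.<? (σ ⟨$⟩ʳ i)) (λ i → i) (λ j → j)

  count-punchIn-< : ∀ {n} (k : Fin (suc n)) →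
                    sumℕ (λ b → ⟦ does (punchIn k b Fin.<? k) ⟧) ≡ toℕ k
  count-punchIn-< {n}     zero    = sum-replicate-zero n
  count-punchIn-< {suc n} (suc k) = ≡.cong suc (count-punchIn-< k)

  punchIn-<-does : ∀ {n} (k : Fin (suc n)) a b →
                   does (punchIn k a Fin.<? punchIn k b) ≡ does (a Fin.<? b)
  punchIn-<-does k a b = does-⇔ (mk⇔
    (λ ka<kb → ℕ.≰⇒> λ b≤a → ℕ.<⇒≱ ka<kb (Fin.punchIn-mono-≤ k b a b≤a))
    (λ a<b → ℕ.≰⇒> λ kb≤ka → ℕ.<⇒≱ a<b (Fin.punchIn-cancel-≤ k b a kb≤ka)))
    (punchIn k a Fin.<? punchIn k b) (a Fin.<? b)

  inversions-insert : ∀ {n} (k : Fin (suc n)) (π : Permutation′ n) →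
                      inversions (insert zero k π) ≡ toℕ k ℕ.+ inversions π
  inversions-insert k π = ≡.trans (inversions-sum (insert zero k π)) (≡.cong₂ ℕ._+_
    (begin
      sumℕ (λ b → ⟦ does (punchIn k (π ⟨$⟩ʳ b) Fin.<? k) ⟧)
        ≡⟨ sum-permute (λ b → ⟦ does (punchIn k b Fin.<? k) ⟧) π ⟨
      sumℕ (λ b → ⟦ does (punchIn k b Fin.<? k) ⟧)
        ≡⟨ count-punchIn-< k ⟩
      toℕ k ∎)
    (≡.trans
      (sum-cong-≗ λ i → sum-cong-≗ λ j → ≡.cong (λ b → ⟦ does (i Fin.<? j) Data.Bool.Base.∧ b ⟧)
        (punchIn-<-does k (π ⟨$⟩ʳ j) (π ⟨$⟩ʳ i)))
      (≡.sym (inversions-sum π))))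

module Sums {c ℓ} (S : CommutativeRing c ℓ) where
  open CommutativeRing S hiding (zero)
  open SumsAndDeterminants rawRing
  open Algebra.Properties.Semiring.Sum semiring
  open Algebra.Properties.Semiring.Mult semiring using () renaming (_×_ to _·_)
  open Algebra.Properties.CommutativeSemigroup +-commutativeSemigroup using (interchange)
  open SetoidReasoning setoid

  Σ-cong : ∀ {a} {A : Set a} (xs : List A) {f g : A → Carrier} → (∀ x → f x ≈ g x) → Σ[ xs ] f ≈ Σ[ xs ] g
  Σ-cong []       f≈g = refl
  Σ-cong (x ∷ xs) f≈g = +-cong (f≈g x) (Σ-cong xs f≈g)

  Σ-+ : ∀ {a} {A : Set a} (xs : List A) (f g : A → Carrier) →
        Σ[ xs ] (λ x → f x + g x) ≈ Σ[ xs ] f + Σ[ xs ] g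
  Σ-+ []       f g = sym (+-identityˡ 0#)
  Σ-+ (x ∷ xs) f g = trans (+-congˡ (Σ-+ xs f g)) (interchange (f x) (g x) _ _)

  Σ-* : ∀ {a} {A : Set a} (xs : List A) y (f : A → Carrier) → Σ[ xs ] (λ x → y * f x) ≈ y * Σ[ xs ] f
  Σ-* []       y f = sym (zeroʳ y)
  Σ-* (x ∷ xs) y f = trans (+-congˡ (Σ-* xs y f)) (sym (distribˡ y _ _))

  Σ-const : ∀ {a} {A : Set a} (xs : List A) y → Σ[ xs ] (λ _ → y) ≈ length xs · y
  Σ-const []       y = refl
  Σ-const (x ∷ xs) y = +-congˡ (Σ-const xs y)

  Σ-++ : ∀ {a} {A : Set a} (xs ys : List A) f → Σ[ xs ++ ys ] f ≈ Σ[ xs ] f + Σ[ ys ] f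
  Σ-++ []       ys f = sym (+-identityˡ _)
  Σ-++ (x ∷ xs) ys f = trans (+-congˡ (Σ-++ xs ys f)) (sym (+-assoc _ _ _))

  Σ-map : ∀ {a b} {A : Set a} {B : Set b} (g : A → B) xs f → Σ[ map g xs ] f ≡ Σ[ xs ] (f ∘ g)
  Σ-map g []       f = ≡.refl
  Σ-map g (x ∷ xs) f = ≡.cong (f (g x) +_) (Σ-map g xs f)

  Σ-tabulate : ∀ {a} {A : Set a} {n} (g : Fin n → A) f → Σ[ tabulate g ] f ≡ sum (f ∘ g)
  Σ-tabulate {n = zero}  g f = ≡.refl
  Σ-tabulate {n = suc n} g f = ≡.cong (f (g zero) +_) (Σ-tabulate (g ∘ suc) f)

  Σ-concatMap : ∀ {a b} {A : Set a} {B : Set b} (g : A → List B) xs f →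
                Σ[ concatMap g xs ] f ≈ Σ[ xs ] (λ x → Σ[ g x ] f)
  Σ-concatMap g []       f = refl
  Σ-concatMap g (x ∷ xs) f = trans (Σ-++ (g x) (concatMap g xs) f) (+-congˡ (Σ-concatMap g xs f))

  Σ-concatMap-allFin : ∀ {b} {B : Set b} {n} (g : Fin n → List B) f →
                       Σ[ concatMap g (allFin n) ] f ≈ sum (λ i → Σ[ g i ] f)
  Σ-concatMap-allFin {n = n} g f = trans (Σ-concatMap g (allFin n) f)
    (reflexive (Σ-tabulate (λ i → i) (λ i → Σ[ g i ] f)))

  indicator : Bool → Carrier
  indicator b = if b then 1# else 0#

  δ-refl : ∀ {n} (i : Fin n) → identity i i ≈ 1#
  δ-refl zero    = refl
  δ-refl (suc i) = δ-refl i

  δ-≢ : ∀ {n} {i j : Fin n} → i ≢ j → identity i j ≈ 0#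
  δ-≢ {i = i} {j} i≢j with i Fin.≟ j
  ... | yes i≡j = contradiction i≡j i≢j
  ... | no _    = refl

  δ-sym : ∀ {n} (i j : Fin n) → identity i j ≈ identity j i
  δ-sym i j = reflexive (≡.cong indicator (does-⇔ (mk⇔ ≡.sym ≡.sym) (i Fin.≟ j) (j Fin.≟ i)))

  sum-δ : ∀ {n} (f : Vector Carrier n) l → sum (λ j → f j * identity j l) ≈ f l
  sum-δ {suc n} f l = begin
    sum (λ j → f j * identity j l)
      ≈⟨ sum-remove {i = l} (λ j → f j * identity j l) ⟩
    f l * identity l l + sum (λ j → f (punchIn l j) * identity (punchIn l j) l)
      ≈⟨ +-cong (trans (*-congˡ (δ-refl l)) (*-identityʳ (f l)))
           (trans (sum-cong-≋ λ j → trans (*-congˡ {f (punchIn l j)} (δ-≢ (Fin.punchInᵢ≢i l j))) (zeroʳ _))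
             (sum-replicate-zero n)) ⟩
    f l + 0# ≈⟨ +-identityʳ (f l) ⟩
    f l      ∎

-- Laplace expansion

-- The parameter η is -1 for the determinant and 1 for the permanent.
module LaplaceExpansion {c ℓ} (S : CommutativeRing c ℓ) (η : CommutativeRing.Carrier S)
  (η*η≈1 : CommutativeRing._≈_ S (CommutativeRing._*_ S η η) (CommutativeRing.1# S)) where
  open CommutativeRing S hiding (zero)
  open SumsAndDeterminants rawRing
  open Algebra.Properties.Semiring.Sum semiring
  open Algebra.Properties.Semiring.Exp semiring using (_^_; ^-homo-*; ^-congʳ)
  open Algebra.Properties.CommutativeSemigroup *-commutativeSemigroup
    using (x∙yz≈y∙xz; interchange)
  open RawSemiringDefinitions (RawRing.rawSemiring rawRing) using (product)
  open SetoidReasoning setoid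
  open Sums S

  D : ∀ {n} → Matrix Carrier n → Carrier
  D {zero}  M = 1#
  D {suc n} M = sum λ k → η ^ toℕ k * (M zero k * D (minor zero k M))

  D-cong : ∀ {n} {M N : Matrix Carrier n} → (∀ i j → M i j ≈ N i j) → D M ≈ D N
  D-cong {zero}  M≈N = refl
  D-cong {suc n} M≈N = sum-cong-≋ λ k →
    *-congˡ {η ^ toℕ k} (*-cong (M≈N zero k) (D-cong λ a b → M≈N (suc a) (punchIn k b)))

  ≔-cong : ∀ {n} {M N : Matrix Carrier n} k {u v : Vector Carrier n} →
           (∀ i j → i ≢ k → M i j ≈ N i j) → (∀ j → u j ≈ v j) →
           ∀ i j → (M [ k ]≔ u) i j ≈ (N [ k ]≔ v) i j
  ≔-cong {M = M} {N} k {u} {v} M≈N u≈v i j with i Fin.≟ k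
  ... | yes ≡.refl = trans (reflexive (≡.cong-app (≔-row M i u) j))
                    (trans (u≈v j) (sym (reflexive (≡.cong-app (≔-row N i v) j))))
  ... | no i≢k     = trans (reflexive (≡.cong-app (≔-other M u i≢k) j))
                    (trans (M≈N i j i≢k) (sym (reflexive (≡.cong-app (≔-other N v i≢k) j))))

  D-congʳ : ∀ {n} (M : Matrix Carrier n) k {u v : Vector Carrier n} →
            (∀ j → u j ≈ v j) → D (M [ k ]≔ u) ≈ D (M [ k ]≔ v)
  D-congʳ M k u≈v = D-cong (≔-cong k (λ _ _ _ → refl) u≈v)

  D-suc : ∀ {n} (M : Matrix Carrier (suc n)) i u → D (M [ suc i ]≔ u) ≈
          sum λ k → η ^ toℕ k * (M zero k * D (minor zero k M [ i ]≔ (u ∘ punchIn k)))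
  D-suc M i u = sum-cong-≋ λ k → *-congˡ {η ^ toℕ k} (*-congˡ {M zero k} (D-cong λ a b →
    reflexive (minor-≔ zero k i M u a b)))

  D-+ : ∀ {n} (M : Matrix Carrier n) i u v →
        D (M [ i ]≔ (λ j → u j + v j)) ≈ D (M [ i ]≔ u) + D (M [ i ]≔ v)
  D-+ {suc n} M zero u v = trans
    (sum-cong-≋ λ k → trans (*-congˡ (distribʳ (D (minor zero k M)) (u k) (v k))) (distribˡ (η ^ toℕ k) _ _))
    (∑-distrib-+ (λ k → η ^ toℕ k * (u k * D (minor zero k M))) (λ k → η ^ toℕ k * (v k * D (minor zero k M))))
  D-+ {suc n} M (suc i) u v = begin
    D (M [ suc i ]≔ (λ j → u j + v j)) ≈⟨ D-suc M i _ ⟩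
    sum (λ k → η ^ toℕ k * (M zero k * D (minor zero k M [ i ]≔ (λ j → u (punchIn k j) + v (punchIn k j)))))
      ≈⟨ sum-cong-≋ (λ k → trans
           (*-congˡ (trans (*-congˡ (D-+ (minor zero k M) i (u ∘ punchIn k) (v ∘ punchIn k)))
                           (distribˡ (M zero k) _ _)))
           (distribˡ (η ^ toℕ k) _ _)) ⟩
    sum (λ k → term u k + term v k)             ≈⟨ ∑-distrib-+ (term u) (term v) ⟩
    sum (term u) + sum (term v)                 ≈⟨ +-cong (D-suc M i u) (D-suc M i v) ⟨
    D (M [ suc i ]≔ u) + D (M [ suc i ]≔ v)     ∎
    where
    term : Vector Carrier (suc n) → Fin (suc n) → Carrier
    term w k = η ^ toℕ k * (M zero k * D (minor zero k M [ i ]≔ (w ∘ punchIn k)))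

  D-* : ∀ {n} (M : Matrix Carrier n) i a u →
        D (M [ i ]≔ (λ j → a * u j)) ≈ a * D (M [ i ]≔ u)
  D-* {suc n} M zero a u = trans
    (sum-cong-≋ λ k → trans (*-congˡ (*-assoc a (u k) (D (minor zero k M)))) (x∙yz≈y∙xz (η ^ toℕ k) a _))
    (sym (*-distribˡ-sum a (λ k → η ^ toℕ k * (u k * D (minor zero k M)))))
  D-* {suc n} M (suc i) a u = begin
    D (M [ suc i ]≔ (λ j → a * u j)) ≈⟨ D-suc M i _ ⟩
    sum (λ k → η ^ toℕ k * (M zero k * D (minor zero k M [ i ]≔ (λ j → a * u (punchIn k j)))))
      ≈⟨ sum-cong-≋ (λ k → trans
           (*-congˡ (trans (*-congˡ (D-* (minor zero k M) i a (u ∘ punchIn k))) (x∙yz≈y∙xz (M zero k) a _)))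
           (x∙yz≈y∙xz (η ^ toℕ k) a _)) ⟩
    sum (λ k → a * term k)   ≈⟨ *-distribˡ-sum a term ⟨
    a * sum term             ≈⟨ *-congˡ (D-suc M i u) ⟨
    a * D (M [ suc i ]≔ u)   ∎
    where
    term : Fin (suc n) → Carrier
    term k = η ^ toℕ k * (M zero k * D (minor zero k M [ i ]≔ (u ∘ punchIn k)))

  D-0 : ∀ {n} (M : Matrix Carrier n) i → D (M [ i ]≔ (λ _ → 0#)) ≈ 0#
  D-0 M i = begin
    D (M [ i ]≔ (λ _ → 0#))      ≈⟨ D-congʳ M i (λ _ → zeroˡ 0#) ⟨
    D (M [ i ]≔ (λ _ → 0# * 0#)) ≈⟨ D-* M i 0# (λ _ → 0#) ⟩
    0# * _                       ≈⟨ zeroˡ _ ⟩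
    0#                           ∎

  D-sum : ∀ {n m} (M : Matrix Carrier n) i (u : Fin m → Vector Carrier n) →
          D (M [ i ]≔ (λ j → sum λ k → u k j)) ≈ sum λ k → D (M [ i ]≔ u k)
  D-sum {m = zero}  M i u = D-0 M i
  D-sum {m = suc m} M i u = trans (D-+ M i (u zero) _) (+-congˡ (D-sum M i (u ∘ suc)))

  δ-punchIn-same : ∀ {n} (k : Fin (suc n)) j → identity k (punchIn k j) ≈ 0#
  δ-punchIn-same k j = δ-≢ (Fin.punchInᵢ≢i k j ∘ ≡.sym)

  δ-punchIn : ∀ {n} (k : Fin (suc n)) i j → identity (punchIn k i) (punchIn k j) ≈ identity i j
  δ-punchIn zero    i       j       = refl
  δ-punchIn (suc k) zero    zero    = refl
  δ-punchIn (suc k) zero    (suc j) = refl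
  δ-punchIn (suc k) (suc i) zero    = refl
  δ-punchIn {suc n} (suc k) (suc i) (suc j) = δ-punchIn k i j

  δ-pinch : ∀ {n} (j : Fin (suc (suc n))) (k : Fin (suc n)) l →
            identity j (punchIn (punchIn j k) l) ≈ identity (pinch k j) l
  δ-pinch j k l = trans
    (reflexive (≡.cong (λ i → identity i (punchIn (punchIn j k) l)) (≡.sym (punchIn-punchIn-pinch j k))))
    (δ-punchIn (punchIn j k) (pinch k j) l)

  η²-cancel : ∀ x → η * (η * x) ≈ x
  η²-cancel x = trans (sym (*-assoc η η x)) (trans (*-congʳ η*η≈1) (*-identityˡ x))

  η^-double : ∀ k → η ^ (k ℕ.+ k) ≈ 1#
  η^-double zero    = refl
  η^-double (suc k) = trans (*-congˡ (^-congʳ η (ℕ.+-suc k k))) (trans (η²-cancel _) (η^-double k))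

  η^-pinch : ∀ {n} (j : Fin (suc (suc n))) (k : Fin (suc n)) →
             η ^ (toℕ (punchIn j k) ℕ.+ toℕ (pinch k j)) ≈ η ^ suc (toℕ j ℕ.+ toℕ k)
  η^-pinch zero    k    = ^-congʳ η (≡.cong suc (ℕ.+-identityʳ (toℕ k)))
  η^-pinch (suc j) zero = begin
    η ^ toℕ j                              ≈⟨ η²-cancel _ ⟨
    η ^ suc (suc (toℕ j))                  ≡⟨ ≡.cong (λ m → η ^ suc (suc m)) (ℕ.+-identityʳ (toℕ j)) ⟨
    η ^ suc (suc (toℕ j ℕ.+ 0))            ∎
  η^-pinch {suc n} (suc j) (suc k) = *-congˡ (begin
    η ^ (toℕ (punchIn j k) ℕ.+ suc (toℕ (pinch k j))) ≡⟨ ≡.cong (η ^_) (ℕ.+-suc (toℕ (punchIn j k)) _) ⟩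
    η * η ^ (toℕ (punchIn j k) ℕ.+ toℕ (pinch k j))   ≈⟨ *-congˡ (η^-pinch j k) ⟩
    η * η ^ suc (toℕ j ℕ.+ toℕ k)                     ≡⟨ ≡.cong (λ m → η * η ^ m) (ℕ.+-suc (toℕ j) (toℕ k)) ⟨
    η ^ suc (toℕ j ℕ.+ suc (toℕ k))                   ∎)

  D-expand : ∀ {n} (i j : Fin (suc n)) (M : Matrix Carrier (suc n)) →
             D (M [ i ]≔ identity j) ≈ η ^ (toℕ i ℕ.+ toℕ j) * D (minor i j M)
  D-expand {n} zero j M = begin
    sum (λ k → term (identity j k) k) ≈⟨ sum-remove {i = j} (λ k → term (identity j k) k) ⟩
    term (identity j j) j + sum (λ k → term (identity j (punchIn j k)) (punchIn j k))
      ≈⟨ +-cong (*-congˡ (trans (*-congʳ (δ-refl j)) (*-identityˡ _)))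
                (trans (sum-cong-≋ λ k → trans (*-congˡ (trans (*-congʳ (δ-punchIn-same j k)) (zeroˡ _))) (zeroʳ _))
                       (sum-replicate-zero n)) ⟩
    η ^ toℕ j * D (minor zero j M) + 0# ≈⟨ +-identityʳ _ ⟩
    η ^ toℕ j * D (minor zero j M) ∎
    where
    term : Carrier → Fin _ → Carrier
    term x k = η ^ toℕ k * (x * D (minor zero k M))
  D-expand {suc n} (suc i) j M = begin
    D (M [ suc i ]≔ identity j)                ≈⟨ D-suc M i (identity j) ⟩
    sum term                                   ≈⟨ sum-remove {i = j} term ⟩
    term j + sum (λ k → term (punchIn j k))    ≈⟨ +-cong vanishing (sum-cong-≋ surviving) ⟩
    0# + sum (λ k → sign * inner k)            ≈⟨ +-identityˡ _ ⟩
    sum (λ k → sign * inner k)                 ≈⟨ *-distribˡ-sum sign inner ⟨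
    sign * D (minor (suc i) j M)               ∎
    where
    sign : Carrier
    sign = η ^ (suc (toℕ i) ℕ.+ toℕ j)
    term : Fin (suc (suc n)) → Carrier
    term k = η ^ toℕ k * (M zero k * D (minor zero k M [ i ]≔ (identity j ∘ punchIn k)))
    inner : Fin (suc n) → Carrier
    inner k = η ^ toℕ k * (M zero (punchIn j k) * D (minor zero k (minor (suc i) j M)))
    vanishing : term j ≈ 0#
    vanishing = trans (*-congˡ (trans (*-congˡ (trans (D-congʳ (minor zero j M) i (δ-punchIn-same j))
      (D-0 (minor zero j M) i))) (zeroʳ _))) (zeroʳ _)
    signs : ∀ k → η ^ toℕ (punchIn j k) * η ^ (toℕ i ℕ.+ toℕ (pinch k j)) ≈ sign * η ^ toℕ k
    signs k = begin
      η ^ p * η ^ (toℕ i ℕ.+ q)           ≈⟨ *-congˡ (^-homo-* η (toℕ i) q) ⟩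
      η ^ p * (η ^ toℕ i * η ^ q)         ≈⟨ x∙yz≈y∙xz (η ^ p) (η ^ toℕ i) (η ^ q) ⟩
      η ^ toℕ i * (η ^ p * η ^ q)         ≈⟨ *-congˡ (^-homo-* η p q) ⟨
      η ^ toℕ i * η ^ (p ℕ.+ q)           ≈⟨ *-congˡ (η^-pinch j k) ⟩
      η ^ toℕ i * (η * η ^ (toℕ j ℕ.+ toℕ k))        ≈⟨ *-congˡ (*-congˡ (^-homo-* η (toℕ j) (toℕ k))) ⟩
      η ^ toℕ i * (η * (η ^ toℕ j * η ^ toℕ k))      ≈⟨ x∙yz≈y∙xz _ η _ ⟩
      η * (η ^ toℕ i * (η ^ toℕ j * η ^ toℕ k))      ≈⟨ *-congˡ (*-assoc _ _ _) ⟨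
      η * (η ^ toℕ i * η ^ toℕ j * η ^ toℕ k)        ≈⟨ *-assoc η _ _ ⟨
      η * (η ^ toℕ i * η ^ toℕ j) * η ^ toℕ k        ≈⟨ *-congʳ (*-congˡ (^-homo-* η (toℕ i) (toℕ j))) ⟨
      sign * η ^ toℕ k ∎
      where
      p = toℕ (punchIn j k)
      q = toℕ (pinch k j)
    surviving : ∀ k → term (punchIn j k) ≈ sign * inner k
    surviving k = begin
      η ^ toℕ j′ * (m * D (minor zero j′ M [ i ]≔ (identity j ∘ punchIn j′)))
        ≈⟨ *-congˡ (*-congˡ (D-congʳ (minor zero j′ M) i (δ-pinch j k))) ⟩
      η ^ toℕ j′ * (m * D (minor zero j′ M [ i ]≔ identity (pinch k j)))
        ≈⟨ *-congˡ (*-congˡ (D-expand i (pinch k j) (minor zero j′ M))) ⟩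
      η ^ toℕ j′ * (m * (s * D (minor i (pinch k j) (minor zero j′ M))))
        ≈⟨ *-congˡ (*-congˡ (*-congˡ (D-cong λ a b →
             reflexive (≡.cong (M (suc (punchIn i a))) (punchIn-comm j k b))))) ⟩
      η ^ toℕ j′ * (m * (s * d))    ≈⟨ *-congˡ (x∙yz≈y∙xz m s d) ⟩
      η ^ toℕ j′ * (s * (m * d))    ≈⟨ *-assoc _ s _ ⟨
      η ^ toℕ j′ * s * (m * d)      ≈⟨ *-congʳ (signs k) ⟩
      sign * η ^ toℕ k * (m * d)    ≈⟨ *-assoc sign _ _ ⟩
      sign * inner k                ∎
      where
      j′ = punchIn j k
      m = M zero j′
      s = η ^ (toℕ i ℕ.+ toℕ (pinch k j))
      d = D (minor zero k (minor (suc i) j M))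

  D-expand-same : ∀ {n} (i : Fin (suc n)) (M : Matrix Carrier (suc n)) →
                  D (M [ i ]≔ identity i) ≈ D (minor i i M)
  D-expand-same i M = trans (D-expand i i M) (trans (*-congʳ (η^-double (toℕ i))) (*-identityˡ _))

  module _ (∂ : Carrier → Carrier) (∂-cong : ∀ {x y} → x ≈ y → ∂ x ≈ ∂ y)
    (∂-+ : ∀ x y → ∂ (x + y) ≈ ∂ x + ∂ y) (∂-* : ∀ x y → ∂ (x * y) ≈ ∂ x * y + x * ∂ y)
    (∂η≈0 : ∂ η ≈ 0#) where
    open Algebra.Properties.Ring ring using (x+x≈x⇒x≈0)

    ∂0≈0 : ∂ 0# ≈ 0#
    ∂0≈0 = x+x≈x⇒x≈0 (∂ 0#) (trans (sym (∂-+ 0# 0#)) (∂-cong (+-identityˡ 0#)))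

    ∂1≈0 : ∂ 1# ≈ 0#
    ∂1≈0 = x+x≈x⇒x≈0 (∂ 1#) (begin
      ∂ 1# + ∂ 1#           ≈⟨ +-cong (*-identityʳ _) (*-identityˡ _) ⟨
      ∂ 1# * 1# + 1# * ∂ 1# ≈⟨ ∂-* 1# 1# ⟨
      ∂ (1# * 1#)           ≈⟨ ∂-cong (*-identityˡ 1#) ⟩
      ∂ 1#                  ∎)

    ∂-const-* : ∀ {a} x → ∂ a ≈ 0# → ∂ (a * x) ≈ a * ∂ x
    ∂-const-* {a} x ∂a≈0 = trans (∂-* a x) (trans (+-congʳ (trans (*-congʳ ∂a≈0) (zeroˡ x))) (+-identityˡ _))

    ∂η^≈0 : ∀ k → ∂ (η ^ k) ≈ 0#
    ∂η^≈0 zero    = ∂1≈0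
    ∂η^≈0 (suc k) = trans (∂-const-* (η ^ k) ∂η≈0) (trans (*-congˡ (∂η^≈0 k)) (zeroʳ η))

    ∂-sum : ∀ {n} (f : Vector Carrier n) → ∂ (sum f) ≈ sum (∂ ∘ f)
    ∂-sum {zero}  f = ∂0≈0
    ∂-sum {suc n} f = trans (∂-+ _ _) (+-congˡ (∂-sum (f ∘ suc)))

    ∂-D : ∀ {n} (M : Matrix Carrier n) → ∂ (D M) ≈ sum λ i → D (M [ i ]≔ (∂ ∘ M i))
    ∂-D {zero}  M = ∂1≈0
    ∂-D {suc n} M = begin
      ∂ (D M)                                          ≈⟨ ∂-sum (λ k → η ^ toℕ k * (M zero k * d k)) ⟩
      sum (λ k → ∂ (η ^ toℕ k * (M zero k * d k)))
        ≈⟨ sum-cong-≋ (λ k → trans (∂-const-* (M zero k * d k) (∂η^≈0 (toℕ k)))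
             (trans (*-congˡ (∂-* (M zero k) (d k))) (distribˡ (η ^ toℕ k) _ _))) ⟩
      sum (λ k → η ^ toℕ k * (∂ (M zero k) * d k) + η ^ toℕ k * (M zero k * ∂ (d k)))
        ≈⟨ ∑-distrib-+ (λ k → η ^ toℕ k * (∂ (M zero k) * d k)) (λ k → η ^ toℕ k * (M zero k * ∂ (d k))) ⟩
      D (M [ zero ]≔ (∂ ∘ M zero)) + sum (λ k → η ^ toℕ k * (M zero k * ∂ (d k)))
        ≈⟨ +-congˡ (begin
          sum (λ k → η ^ toℕ k * (M zero k * ∂ (d k)))
            ≈⟨ sum-cong-≋ (λ k → trans (*-congˡ (trans (*-congˡ {M zero k} (∂-D (minor zero k M)))
                 (*-distribˡ-sum (M zero k) (d′ k)))) (*-distribˡ-sum (η ^ toℕ k) (λ i → M zero k * d′ k i))) ⟩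
          sum (λ k → sum λ i → η ^ toℕ k * (M zero k * d′ k i))
            ≈⟨ ∑-comm (λ k i → η ^ toℕ k * (M zero k * d′ k i)) ⟩
          sum (λ i → sum λ k → η ^ toℕ k * (M zero k * d′ k i))
            ≈⟨ sum-cong-≋ (λ i → D-suc M i (∂ ∘ M (suc i))) ⟨
          sum (λ i → D (M [ suc i ]≔ (∂ ∘ M (suc i)))) ∎) ⟩
      sum (λ i → D (M [ i ]≔ (∂ ∘ M i))) ∎
      where
      d : Fin (suc n) → Carrier
      d k = D (minor zero k M)
      d′ : Fin (suc n) → Fin n → Carrier
      d′ k i = D (minor zero k M [ i ]≔ (∂ ∘ minor zero k M i))

  Σ-Sym : (w : ∀ {n} → Permutation′ n → Carrier) → w (Perm.id {0}) ≈ 1# →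
          (∀ {n} (k : Fin (suc n)) (π : Permutation′ n) → w (insert zero k π) ≈ η ^ toℕ k * w π) →
          ∀ {n} (M : Matrix Carrier n) →
          Σ[ Sym n ] (λ σ → w σ * product (λ k → M k (σ ⟨$⟩ʳ k))) ≈ D M
  Σ-Sym w w-id w-insert {zero}  M = trans (+-identityʳ _) (trans (*-identityʳ _) w-id)
  Σ-Sym w w-id w-insert {suc n} M = trans
    (Σ-concatMap-allFin (λ k → map (insert zero k) (Sym n)) _)
    (sum-cong-≋ λ k → begin
      Σ[ map (insert zero k) (Sym n) ] (λ σ → w σ * product (λ i → M i (σ ⟨$⟩ʳ i)))
        ≡⟨ Σ-map (insert zero k) (Sym n) _ ⟩
      Σ[ Sym n ] (λ π → w (insert zero k π) * (M zero k * prod k π))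
        ≈⟨ Σ-cong (Sym n) (λ π → trans (*-congʳ (w-insert k π))
             (trans (interchange _ _ _ _) (*-assoc (η ^ toℕ k) _ _))) ⟩
      Σ[ Sym n ] (λ π → η ^ toℕ k * (M zero k * (w π * prod k π)))
        ≈⟨ Σ-* (Sym n) _ _ ⟩
      η ^ toℕ k * Σ[ Sym n ] (λ π → M zero k * (w π * prod k π))
        ≈⟨ *-congˡ (trans (Σ-* (Sym n) _ _) (*-congˡ (Σ-Sym w w-id w-insert (minor zero k M)))) ⟩
      η ^ toℕ k * (M zero k * D (minor zero k M)) ∎)
    where
    prod : Fin (suc n) → Permutation′ n → Carrier
    prod k π = product (λ i → minor zero k M i (π ⟨$⟩ʳ i))

  module _ (b c : Carrier) where

    edgeRow : ∀ {n} → Fin n → Fin n → Vector Carrier n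
    edgeRow s t j = b * identity s j + c * identity t j

    D-edgeRows-punchIn : ∀ {n} (s : Fin (suc (suc n))) (t : Fin (suc n)) M →
      D (M [ punchIn s t ]≔ edgeRow (punchIn s t) s [ s ]≔ edgeRow s (punchIn s t)) ≈
      (b * b + η * (c * c)) * D (minor t t (minor s s M))
    D-edgeRows-punchIn s t M = begin
      D (M′ [ s ]≔ edgeRow s t₁)
        ≈⟨ trans (D-+ M′ s _ _) (+-cong (D-* M′ s b _) (D-* M′ s c _)) ⟩
      b * D (M′ [ s ]≔ identity s) + c * D (M′ [ s ]≔ identity t₁)
        ≈⟨ +-cong (*-congˡ parallel) (*-congˡ crossed) ⟩
      b * (b * d) + c * (η * (c * d))
        ≈⟨ +-cong (sym (*-assoc b b d))
             (trans (x∙yz≈y∙xz c η _) (trans (*-congˡ (sym (*-assoc c c d))) (sym (*-assoc η _ d)))) ⟩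
      b * b * d + η * (c * c) * d
        ≈⟨ distribʳ d _ _ ⟨
      (b * b + η * (c * c)) * d ∎
      where
      t₁ = punchIn s t
      s₁ = pinch t s
      M′ = M [ t₁ ]≔ edgeRow t₁ s
      d = D (minor t t (minor s s M))
      parallel : D (M′ [ s ]≔ identity s) ≈ b * d
      parallel = begin
        D (M′ [ s ]≔ identity s)       ≈⟨ D-expand-same s M′ ⟩
        D (minor s s M′)               ≈⟨ D-cong (λ k l → reflexive (minor-≔ s s t M (edgeRow t₁ s) k l)) ⟩
        D (minor s s M [ t ]≔ (edgeRow t₁ s ∘ punchIn s))
          ≈⟨ D-congʳ (minor s s M) t (λ j → trans
               (+-cong (*-congˡ (δ-punchIn s t j)) (trans (*-congˡ (δ-punchIn-same s j)) (zeroʳ c)))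
               (+-identityʳ _)) ⟩
        D (minor s s M [ t ]≔ (λ j → b * identity t j)) ≈⟨ D-* (minor s s M) t b (identity t) ⟩
        b * D (minor s s M [ t ]≔ identity t)           ≈⟨ *-congˡ (D-expand-same t (minor s s M)) ⟩
        b * d ∎
      signs : η ^ (toℕ s ℕ.+ toℕ t₁) * η ^ (toℕ t ℕ.+ toℕ s₁) ≈ η
      signs = begin
        η ^ (toℕ s ℕ.+ toℕ t₁) * η ^ (toℕ t ℕ.+ toℕ s₁)
          ≈⟨ *-cong (^-homo-* η (toℕ s) (toℕ t₁)) (^-homo-* η (toℕ t) (toℕ s₁)) ⟩
        (η ^ toℕ s * η ^ toℕ t₁) * (η ^ toℕ t * η ^ toℕ s₁) ≈⟨ interchange _ _ _ _ ⟩
        (η ^ toℕ s * η ^ toℕ t) * (η ^ toℕ t₁ * η ^ toℕ s₁)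
          ≈⟨ *-cong (^-homo-* η (toℕ s) (toℕ t)) (^-homo-* η (toℕ t₁) (toℕ s₁)) ⟨
        η ^ k * η ^ (toℕ t₁ ℕ.+ toℕ s₁)       ≈⟨ *-congˡ (η^-pinch s t) ⟩
        η ^ k * (η * η ^ k)                   ≈⟨ x∙yz≈y∙xz (η ^ k) η (η ^ k) ⟩
        η * (η ^ k * η ^ k)                   ≈⟨ *-congˡ (trans (sym (^-homo-* η k k)) (η^-double k)) ⟩
        η * 1#                                ≈⟨ *-identityʳ η ⟩
        η ∎
        where k = toℕ s ℕ.+ toℕ t
      crossed : D (M′ [ s ]≔ identity t₁) ≈ η * (c * d)
      crossed = begin
        D (M′ [ s ]≔ identity t₁)       ≈⟨ D-expand s t₁ M′ ⟩
        σ₁ * D (minor s t₁ M′)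
          ≈⟨ *-congˡ (D-cong (λ k l → reflexive (minor-≔ s t₁ t M (edgeRow t₁ s) k l))) ⟩
        σ₁ * D (minor s t₁ M [ t ]≔ (edgeRow t₁ s ∘ punchIn t₁))
          ≈⟨ *-congˡ (D-congʳ (minor s t₁ M) t (λ j → trans
               (+-cong (trans (*-congˡ (δ-punchIn-same t₁ j)) (zeroʳ b)) (*-congˡ (δ-pinch s t j)))
               (+-identityˡ _))) ⟩
        σ₁ * D (minor s t₁ M [ t ]≔ (λ j → c * identity s₁ j))
          ≈⟨ *-congˡ (D-* (minor s t₁ M) t c (identity s₁)) ⟩
        σ₁ * (c * D (minor s t₁ M [ t ]≔ identity s₁))
          ≈⟨ *-congˡ (*-congˡ (D-expand t s₁ (minor s t₁ M))) ⟩
        σ₁ * (c * (σ₂ * D (minor t s₁ (minor s t₁ M))))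
          ≈⟨ *-congˡ (*-congˡ (*-congˡ (D-cong λ k l →
               reflexive (≡.cong (M (punchIn s (punchIn t k))) (punchIn-comm s t l))))) ⟩
        σ₁ * (c * (σ₂ * d))     ≈⟨ *-congˡ (x∙yz≈y∙xz c σ₂ d) ⟩
        σ₁ * (σ₂ * (c * d))     ≈⟨ *-assoc σ₁ σ₂ _ ⟨
        σ₁ * σ₂ * (c * d)       ≈⟨ *-congʳ signs ⟩
        η * (c * d)             ∎
        where
        σ₁ = η ^ (toℕ s ℕ.+ toℕ t₁)
        σ₂ = η ^ (toℕ t ℕ.+ toℕ s₁)

    D-edgeRows : ∀ {n} {s t : Fin n} (s≢t : s ≢ t) M →
      D (M [ t ]≔ edgeRow t s [ s ]≔ edgeRow s t) ≈ (b * b + η * (c * c)) * D (delete₂ s≢t M)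
    D-edgeRows {1} {zero} {zero} s≢t M = contradiction ≡.refl s≢t
    D-edgeRows {suc (suc n)} {s} {t} s≢t M = ≡.subst
      (λ r → D (M [ r ]≔ edgeRow r s [ s ]≔ edgeRow s r) ≈ (b * b + η * (c * c)) * D (delete₂ s≢t M))
      (Fin.punchIn-punchOut s≢t) (D-edgeRows-punchIn s (punchOut s≢t) M)

module _ {c ℓ} (S : CommutativeRing c ℓ) where
  open CommutativeRing S hiding (zero)
  open SumsAndDeterminants rawRing
  open Algebra.Properties.Semiring.Exp semiring using (_^_; ^-homo-*; ^-congʳ)
  open Algebra.Properties.Ring ring using (-1*x≈-x; -‿involutive)
  open Sums S

  -1*-1≈1 : (- 1#) * (- 1#) ≈ 1#
  -1*-1≈1 = trans (-1*x≈-x (- 1#)) (-‿involutive 1#)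

  det≈D : ∀ {n} (M : Matrix Carrier n) → det M ≈ LaplaceExpansion.D S (- 1#) -1*-1≈1 M
  det≈D = LaplaceExpansion.Σ-Sym S (- 1#) -1*-1≈1 sgn refl λ k π →
    trans (^-congʳ (- 1#) (inversions-insert k π)) (^-homo-* (- 1#) (toℕ k) (inversions π))

  per≈D : ∀ {n} (M : Matrix Carrier n) → per M ≈ LaplaceExpansion.D S 1# (*-identityˡ 1#) M
  per≈D {n} M = trans (Σ-cong (Sym n) λ σ → sym (*-identityˡ _))
    (LaplaceExpansion.Σ-Sym S 1# (*-identityˡ 1#) (λ _ → 1#) refl
      (λ k π → sym (trans (*-identityʳ _) (1^ (toℕ k)))) M)
    where
    1^ : ∀ k → 1# ^ k ≈ 1#
    1^ zero    = refl
    1^ (suc k) = trans (*-identityˡ _) (1^ k)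

-- Edge deletion

module GraphSums {c ℓ} (S : CommutativeRing c ℓ) where
  open CommutativeRing S hiding (zero)
  open SumsAndDeterminants rawRing
  open Algebra.Properties.Semiring.Sum semiring
  open SetoidReasoning setoid
  open Sums S
  open Graph

  adjacency : ∀ {n} → Graph n → Matrix Carrier n
  adjacency G i j = indicator (adj G i j)

  upper : ∀ {n} → Graph n → Matrix Carrier n
  upper G i j = indicator (does (i Fin.<? j ×-dec T? (adj G i j)))

  upper+lower : ∀ {n} (G : Graph n) i j → upper G i j + upper G j i ≈ adjacency G i j
  upper+lower G i j with Fin.<-cmp i j
  ... | tri< i<j _ j≮i rewrite dec-true (i Fin.<? j) i<j | dec-false (j Fin.<? i) j≮i = +-identityʳ _
  ... | tri> i≮j _ j<i rewrite dec-true (j Fin.<? i) j<i | dec-false (i Fin.<? j) i≮j | adj-sym G i j = +-identityˡ _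
  ... | tri≈ i≮i ≡.refl _ rewrite dec-false (i Fin.<? i) i≮i | adj-irrefl G i = +-identityˡ 0#

  Σ-edgeBetween : ∀ {n} (G : Graph n) s t (f : Fin n → Fin n → Carrier) →
                  Σ[ edgeBetween G s t ] (λ e → f (Edge.s e) (Edge.t e)) ≈ upper G s t * f s t
  Σ-edgeBetween G s t f with s Fin.<? t ×-dec T? (adj G s t)
  ... | yes st = trans (+-identityʳ _) (sym (trans (*-congʳ (reflexive (≡.cong indicator
    (dec-true (s Fin.<? t ×-dec T? (adj G s t)) st)))) (*-identityˡ _)))
  ... | no ¬st = sym (trans (*-congʳ (reflexive (≡.cong indicator
    (dec-false (s Fin.<? t ×-dec T? (adj G s t)) ¬st)))) (zeroˡ _))

  Σ-edges : ∀ {n} (G : Graph n) (f : Fin n → Fin n → Carrier) →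
            Σ[ edges G ] (λ e → f (Edge.s e) (Edge.t e)) ≈ sum λ s → sum λ t → upper G s t * f s t
  Σ-edges {n} G f = trans (Σ-concatMap-allFin (λ s → concatMap (edgeBetween G s) (allFin n)) _)
    (sum-cong-≋ λ s → trans (Σ-concatMap-allFin (edgeBetween G s) _)
      (sum-cong-≋ λ t → Σ-edgeBetween G s t f))

  Σ-edges-sym : ∀ {n} (G : Graph n) (f : Fin n → Fin n → Carrier) →
                Σ[ edges G ] (λ e → f (Edge.s e) (Edge.t e) + f (Edge.t e) (Edge.s e)) ≈
                sum λ i → sum λ j → adjacency G i j * f i j
  Σ-edges-sym G f = begin
    Σ[ edges G ] (λ e → f (Edge.s e) (Edge.t e) + f (Edge.t e) (Edge.s e))
      ≈⟨ Σ-edges G (λ s t → f s t + f t s) ⟩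
    (sum λ i → sum λ j → upper G i j * (f i j + f j i))
      ≈⟨ sum-cong-≋ (λ i → trans (sum-cong-≋ λ j → distribˡ (upper G i j) (f i j) (f j i))
           (∑-distrib-+ (λ j → upper G i j * f i j) (λ j → upper G i j * f j i))) ⟩
    (sum λ i → (sum λ j → upper G i j * f i j) + (sum λ j → upper G i j * f j i))
      ≈⟨ ∑-distrib-+ (λ i → sum λ j → upper G i j * f i j) (λ i → sum λ j → upper G i j * f j i) ⟩
    (sum λ i → sum λ j → upper G i j * f i j) + (sum λ i → sum λ j → upper G i j * f j i)
      ≈⟨ +-congˡ (∑-comm (λ i j → upper G i j * f j i)) ⟩
    (sum λ i → sum λ j → upper G i j * f i j) + (sum λ i → sum λ j → upper G j i * f i j)
      ≈⟨ ∑-distrib-+ (λ i → sum λ j → upper G i j * f i j) (λ i → sum λ j → upper G j i * f i j) ⟨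
    (sum λ i → (sum λ j → upper G i j * f i j) + (sum λ j → upper G j i * f i j))
      ≈⟨ sum-cong-≋ (λ i → trans (sym (∑-distrib-+ (λ j → upper G i j * f i j) (λ j → upper G j i * f i j)))
           (sum-cong-≋ λ j → trans (sym (distribʳ (f i j) (upper G i j) (upper G j i)))
             (*-congʳ (upper+lower G i j)))) ⟩
    (sum λ i → sum λ j → adjacency G i j * f i j) ∎

  deg : ∀ {n} → Graph n → Vector Carrier n
  deg G i = sum (adjacency G i)

  private
    indicator-∧-not : ∀ a q → (q ≡ true → a ≡ true) →
                      indicator a ≈ indicator (a ∧ not q) + indicator q
    indicator-∧-not a     true  q⇒a rewrite q⇒a ≡.refl = sym (+-identityˡ 1#)
    indicator-∧-not true  false q⇒a = sym (+-identityʳ 1#)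
    indicator-∧-not false false q⇒a = sym (+-identityʳ 0#)

    indicator-split : ∀ a p q r u → (p ≡ true → q ≡ true → a ≡ true) →
                      (r ≡ true → u ≡ true → a ≡ true) → (p ≡ true → ¬ r ≡ true) →
                      indicator a ≈ indicator (a ∧ not ((p ∧ q) ∨ (r ∧ u))) +
                                    (indicator p * indicator q + indicator r * indicator u)
    indicator-split a true  q true  u pq⇒a ru⇒a p⇒¬r = contradiction ≡.refl (p⇒¬r ≡.refl)
    indicator-split a true  q false u pq⇒a ru⇒a p⇒¬r rewrite ∨-identityʳ q = trans
      (indicator-∧-not a q (pq⇒a ≡.refl))
      (+-congˡ (sym (trans (+-cong (*-identityˡ _) (zeroˡ _)) (+-identityʳ _))))
    indicator-split a false q true  u pq⇒a ru⇒a p⇒¬r = trans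
      (indicator-∧-not a u (ru⇒a ≡.refl))
      (+-congˡ (sym (trans (+-cong (zeroˡ _) (*-identityˡ _)) (+-identityˡ _))))
    indicator-split a false q false u pq⇒a ru⇒a p⇒¬r = trans
      (indicator-∧-not a false λ ())
      (+-congˡ (sym (trans (+-cong (zeroˡ _) (zeroˡ _)) (+-identityˡ 0#))))

  module _ {n} (G : Graph n) (e : Edge G) where
    open Edge e

    private
      ≟⇒≡ : ∀ (i j : Fin n) → does (i Fin.≟ j) ≡ true → i ≡ j
      ≟⇒≡ i j eq with i Fin.≟ j
      ... | yes i≡j = i≡j

      adj-st : adj G s t ≡ true
      adj-st with adj G s t | adjacent
      ... | true | _ = ≡.refl

    adjacency-∖ : ∀ i j → adjacency G i j ≈
      adjacency (G ∖ e) i j + (identity i s * identity j t + identity i t * identity j s)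
    adjacency-∖ i j = indicator-split (adj G i j) _ _ _ _
      (λ i≡s j≡t → ≡.trans (≡.cong₂ (adj G) (≟⇒≡ i s i≡s) (≟⇒≡ j t j≡t)) adj-st)
      (λ i≡t j≡s → ≡.trans (≡.cong₂ (adj G) (≟⇒≡ i t i≡t) (≟⇒≡ j s j≡s)) (≡.trans (adj-sym G t s) adj-st))
      (λ i≡s i≡t → s≢t (≡.trans (≡.sym (≟⇒≡ i s i≡s)) (≟⇒≡ i t i≡t)))

    deg-∖ : ∀ i → deg G i ≈ deg (G ∖ e) i + (identity i s + identity i t)
    deg-∖ i = begin
      sum (adjacency G i)
        ≈⟨ sum-cong-≋ (adjacency-∖ i) ⟩
      sum (λ j → adjacency (G ∖ e) i j + (identity i s * identity j t + identity i t * identity j s))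
        ≈⟨ ∑-distrib-+ (adjacency (G ∖ e) i) _ ⟩
      deg (G ∖ e) i + sum (λ j → identity i s * identity j t + identity i t * identity j s)
        ≈⟨ +-congˡ (trans (∑-distrib-+ (λ j → identity i s * identity j t) (λ j → identity i t * identity j s))
             (+-cong (sum-δ (λ _ → identity i s) t) (sum-δ (λ _ → identity i t) s))) ⟩
      deg (G ∖ e) i + (identity i s + identity i t) ∎

module EdgeDeletion {c ℓ} (S : CommutativeRing c ℓ) (η : CommutativeRing.Carrier S)
  (η*η≈1 : CommutativeRing._≈_ S (CommutativeRing._*_ S η η) (CommutativeRing.1# S))
  (x b c : CommutativeRing.Carrier S) where
  open CommutativeRing S hiding (zero)
  open SumsAndDeterminants rawRing
  open Algebra.Properties.Semiring.Sum semiring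
  open Algebra.Properties.Semiring.Mult semiring using (×-congʳ; ×-assoc-*) renaming (_×_ to _·_)
  open Algebra.Properties.Ring ring using (-‿+-comm; [y-z]x≈yx-zx; //-rightDividesˡ; //-rightDividesʳ)
  open Algebra.Properties.CommutativeSemigroup +-commutativeSemigroup
    using (xy∙z≈xz∙y; xy∙z≈x∙zy)
  private module Mul = Algebra.Properties.CommutativeSemigroup *-commutativeSemigroup
  open SetoidReasoning setoid
  open LaplaceExpansion S η η*η≈1
  open Sums S
  open GraphSums S

  graphMatrix : ∀ {n} → Graph n → Matrix Carrier n
  graphMatrix G i j = x * identity i j - b * (deg G i * identity i j) - c * adjacency G i j

  sum-edgeRow : ∀ {n} (G : Graph n) i j →
    sum (λ k → adjacency G i k * edgeRow b c i k j) ≈ b * (deg G i * identity i j) + c * adjacency G i j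
  sum-edgeRow G i j = begin
    sum (λ k → adjacency G i k * (b * identity i j + c * identity k j))
      ≈⟨ trans (sum-cong-≋ λ k → trans (distribˡ (adjacency G i k) _ _)
           (+-cong (Mul.x∙yz≈y∙xz _ b _) (Mul.x∙yz≈y∙xz _ c _)))
           (∑-distrib-+ (λ k → b * (adjacency G i k * identity i j)) (λ k → c * (adjacency G i k * identity k j))) ⟩
    sum (λ k → b * (adjacency G i k * identity i j)) + sum (λ k → c * (adjacency G i k * identity k j))
      ≈⟨ +-cong
           (trans (*-congˡ (*-distribʳ-sum (identity i j) (adjacency G i)))
                  (*-distribˡ-sum b (λ k → adjacency G i k * identity i j)))
           (trans (*-congˡ (sym (sum-δ (adjacency G i) j)))
                  (*-distribˡ-sum c (λ k → adjacency G i k * identity k j))) ⟨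
    b * (deg G i * identity i j) + c * adjacency G i j ∎

  graphMatrix+sum-edgeRow : ∀ {n} (G : Graph n) i j →
    sum (λ k → adjacency G i k * edgeRow b c i k j) + graphMatrix G i j ≈ x * identity i j
  graphMatrix+sum-edgeRow G i j = begin
    sum (λ k → adjacency G i k * edgeRow b c i k j) + (xδ - p - q)
      ≈⟨ +-comm _ _ ⟩
    (xδ - p - q) + sum (λ k → adjacency G i k * edgeRow b c i k j)
      ≈⟨ +-congˡ (trans (sum-edgeRow G i j) (+-comm p q)) ⟩
    (xδ - p - q) + (q + p)    ≈⟨ +-assoc _ q p ⟨
    (xδ - p - q) + q + p      ≈⟨ +-congʳ (//-rightDividesˡ q (xδ - p)) ⟩
    (xδ - p) + p              ≈⟨ //-rightDividesˡ p xδ ⟩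
    xδ ∎
    where
    xδ = x * identity i j
    p = b * (deg G i * identity i j)
    q = c * adjacency G i j

  private
    minus-part : ∀ {y z z′ u} → z ≈ z′ + u → y - z′ ≈ (y - z) + u
    minus-part {y} {z} {z′} {u} z≈z′+u = sym (begin
      (y - z) + u             ≈⟨ +-congʳ (+-congˡ (trans (-‿cong z≈z′+u) (sym (-‿+-comm z′ u)))) ⟩
      (y + (- z′ - u)) + u    ≈⟨ +-congʳ (+-assoc y (- z′) (- u)) ⟨
      ((y - z′) - u) + u      ≈⟨ //-rightDividesˡ u (y - z′) ⟩
      y - z′                  ∎)

  module _ {n} (G : Graph n) (e : Edge G) where
    open Edge e

    private
      M : Matrix Carrier n
      M = graphMatrix G

      extra : Matrix Carrier n
      extra i j = b * ((identity i s + identity i t) * identity i j) +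
                  c * (identity i s * identity j t + identity i t * identity j s)

    graphMatrix-∖-+ : ∀ i j → graphMatrix (G ∖ e) i j ≈ M i j + extra i j
    graphMatrix-∖-+ i j = begin
      (x * identity i j - p′) - q′
        ≈⟨ minus-part (trans (*-congˡ (adjacency-∖ G e i j)) (distribˡ c _ _)) ⟩
      ((x * identity i j - p′) - q) + v
        ≈⟨ +-congʳ (+-congʳ (minus-part
             (trans (*-congˡ (trans (*-congʳ (deg-∖ G e i)) (distribʳ _ _ _))) (distribˡ b _ _)))) ⟩
      (((x * identity i j - p) + u) - q) + v  ≈⟨ +-congʳ (xy∙z≈xz∙y (x * identity i j - p) u (- q)) ⟩
      (((x * identity i j - p) - q) + u) + v  ≈⟨ +-assoc _ u v ⟩
      M i j + (u + v)                         ∎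
      where
      p = b * (deg G i * identity i j)
      p′ = b * (deg (G ∖ e) i * identity i j)
      q = c * adjacency G i j
      q′ = c * adjacency (G ∖ e) i j
      u = b * ((identity i s + identity i t) * identity i j)
      v = c * (identity i s * identity j t + identity i t * identity j s)

    extra-s : ∀ j → extra s j ≈ edgeRow b c s t j
    extra-s j = +-cong
      (*-congˡ (trans (*-congʳ (trans (+-cong (δ-refl s) (δ-≢ s≢t)) (+-identityʳ 1#))) (*-identityˡ _)))
      (*-congˡ (trans (+-cong (trans (*-congʳ (δ-refl s)) (*-identityˡ _)) (trans (*-congʳ (δ-≢ s≢t)) (zeroˡ _)))
        (trans (+-identityʳ _) (δ-sym j t))))

    extra-t : ∀ j → extra t j ≈ edgeRow b c t s j
    extra-t j = +-cong
      (*-congˡ (trans (*-congʳ (trans (+-cong (δ-≢ (s≢t ∘ ≡.sym)) (δ-refl t)) (+-identityˡ 1#))) (*-identityˡ _)))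
      (*-congˡ (trans (+-cong
          (trans (*-congʳ (δ-≢ (s≢t ∘ ≡.sym))) (zeroˡ _))
          (trans (*-congʳ (δ-refl t)) (*-identityˡ _)))
        (trans (+-identityˡ _) (δ-sym j s))))

    extra-other : ∀ {i} → i ≢ s → i ≢ t → ∀ j → extra i j ≈ 0#
    extra-other i≢s i≢t j = trans (+-cong
      (trans (*-congˡ (trans (*-congʳ (trans (+-cong (δ-≢ i≢s) (δ-≢ i≢t)) (+-identityˡ 0#))) (zeroˡ _))) (zeroʳ b))
      (trans (*-congˡ (trans (+-cong (trans (*-congʳ (δ-≢ i≢s)) (zeroˡ _)) (trans (*-congʳ (δ-≢ i≢t)) (zeroˡ _)))
        (+-identityˡ 0#))) (zeroʳ c))) (+-identityˡ 0#)

    private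
      Mₜ : Matrix Carrier n
      Mₜ = M [ t ]≔ (λ j → M t j + edgeRow b c t s j)

    graphMatrix-∖ : ∀ i j → graphMatrix (G ∖ e) i j ≈ (Mₜ [ s ]≔ (λ j → M s j + edgeRow b c s t j)) i j
    graphMatrix-∖ i j = trans (graphMatrix-∖-+ i j) (sym (go (i Fin.≟ s) (i Fin.≟ t)))
      where
      go : Dec (i ≡ s) → Dec (i ≡ t) → (Mₜ [ s ]≔ (λ j → M s j + edgeRow b c s t j)) i j ≈ M i j + extra i j
      go (yes ≡.refl) _ = trans (reflexive (≡.cong-app (≔-row Mₜ s _) j)) (+-congˡ (sym (extra-s j)))
      go (no i≢s) (yes ≡.refl) = trans (reflexive (≡.cong-app (≔-other Mₜ _ i≢s) j))
        (trans (reflexive (≡.cong-app (≔-row M t _) j)) (+-congˡ (sym (extra-t j))))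
      go (no i≢s) (no i≢t) = trans (reflexive (≡.cong-app (≔-other Mₜ _ i≢s) j))
        (trans (reflexive (≡.cong-app (≔-other M _ i≢t) j))
          (sym (trans (+-congˡ (extra-other i≢s i≢t j)) (+-identityʳ _))))

    D-∖ : D (graphMatrix (G ∖ e)) ≈
          (D M + (D (M [ s ]≔ edgeRow b c s t) + D (M [ t ]≔ edgeRow b c t s))) +
          (b * b + η * (c * c)) * D (delete₂ s≢t M)
    D-∖ = begin
      D (graphMatrix (G ∖ e))
        ≈⟨ trans (D-cong graphMatrix-∖) (D-+ Mₜ s (M s) eₛ) ⟩
      D (Mₜ [ s ]≔ M s) + D (Mₜ [ s ]≔ eₛ)
        ≈⟨ +-cong restore swap ⟩
      (D M + D (M [ t ]≔ eₜ)) + (D (M [ s ]≔ eₛ) + W * D (delete₂ s≢t M))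
        ≈⟨ +-assoc _ _ _ ⟨
      ((D M + D (M [ t ]≔ eₜ)) + D (M [ s ]≔ eₛ)) + W * D (delete₂ s≢t M)
        ≈⟨ +-congʳ (xy∙z≈x∙zy _ _ _) ⟩
      (D M + (D (M [ s ]≔ eₛ) + D (M [ t ]≔ eₜ))) + W * D (delete₂ s≢t M) ∎
      where
      eₛ = edgeRow b c s t
      eₜ = edgeRow b c t s
      W = b * b + η * (c * c)
      D-unchanged : ∀ (N : Matrix Carrier n) k {u} → u ≡ N k → D (N [ k ]≔ u) ≈ D N
      D-unchanged N k u≡Nk = D-cong λ i j →
        reflexive (≡.cong-app (Vector.updateAt-id-local k N u≡Nk i) j)
      restore : D (Mₜ [ s ]≔ M s) ≈ D M + D (M [ t ]≔ eₜ)
      restore = begin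
        D (Mₜ [ s ]≔ M s)              ≈⟨ D-unchanged Mₜ s (≡.sym (≔-other M _ s≢t)) ⟩
        D Mₜ                           ≈⟨ D-+ M t (M t) eₜ ⟩
        D (M [ t ]≔ M t) + D (M [ t ]≔ eₜ) ≈⟨ +-congʳ (D-unchanged M t ≡.refl) ⟩
        D M + D (M [ t ]≔ eₜ)          ∎
      Mₛ : Matrix Carrier n
      Mₛ = M [ s ]≔ eₛ
      commute : ∀ u → D (M [ t ]≔ u [ s ]≔ eₛ) ≈ D (Mₛ [ t ]≔ u)
      commute u = D-cong λ i j → reflexive (≡.cong-app (Vector.updateAt-commutes s t s≢t M i) j)
      swap : D (Mₜ [ s ]≔ eₛ) ≈ D Mₛ + W * D (delete₂ s≢t M)
      swap = begin
        D (Mₜ [ s ]≔ eₛ)                                ≈⟨ commute _ ⟩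
        D (Mₛ [ t ]≔ (λ j → M t j + eₜ j))              ≈⟨ D-+ Mₛ t (M t) eₜ ⟩
        D (Mₛ [ t ]≔ M t) + D (Mₛ [ t ]≔ eₜ)
          ≈⟨ +-cong (D-unchanged Mₛ t (≡.sym (≔-other M eₛ (s≢t ∘ ≡.sym)))) (sym (commute eₜ)) ⟩
        D Mₛ + D (M [ t ]≔ eₜ [ s ]≔ eₛ)                ≈⟨ +-congˡ (D-edgeRows b c s≢t M) ⟩
        D Mₛ + W * D (delete₂ s≢t M)                    ∎

  module _ (∂ : Carrier → Carrier) (∂-cong : ∀ {x y} → x ≈ y → ∂ x ≈ ∂ y)
    (∂-+ : ∀ x y → ∂ (x + y) ≈ ∂ x + ∂ y) (∂-* : ∀ x y → ∂ (x * y) ≈ ∂ x * y + x * ∂ y)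
    (∂η≈0 : ∂ η ≈ 0#) {n} (G : Graph n) (∂M≈δ : ∀ i j → ∂ (graphMatrix G i j) ≈ identity i j) where

    private
      M : Matrix Carrier n
      M = graphMatrix G

    firstOrder : Carrier
    firstOrder = Σ[ edges G ] λ e → let open Edge e in
      D (M [ s ]≔ edgeRow b c s t) + D (M [ t ]≔ edgeRow b c t s)

    firstOrder-rows : firstOrder ≈ sum λ i → D (M [ i ]≔ λ j → sum λ k → adjacency G i k * edgeRow b c i k j)
    firstOrder-rows = trans (Σ-edges-sym G (λ i k → D (M [ i ]≔ edgeRow b c i k)))
      (sum-cong-≋ λ i → sym (trans (D-sum M i (λ k j → adjacency G i k * edgeRow b c i k j))
        (sum-cong-≋ λ k → D-* M i (adjacency G i k) (edgeRow b c i k))))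

    firstOrder-deriv : firstOrder + n · D M ≈ x * ∂ (D M)
    firstOrder-deriv = begin
      firstOrder + n · D M
        ≈⟨ +-cong firstOrder-rows (trans (sym (sum-replicate n)) (sum-cong-≋ λ i → D-cong λ k j →
             sym (reflexive (≡.cong-app (Vector.updateAt-id-local i M ≡.refl k) j)))) ⟩
      sum (λ i → D (M [ i ]≔ L i)) + sum (λ i → D (M [ i ]≔ M i))
        ≈⟨ ∑-distrib-+ (λ i → D (M [ i ]≔ L i)) (λ i → D (M [ i ]≔ M i)) ⟨
      sum (λ i → D (M [ i ]≔ L i) + D (M [ i ]≔ M i))
        ≈⟨ sum-cong-≋ (λ i → trans (sym (D-+ M i (L i) (M i)))
             (trans (D-congʳ M i (graphMatrix+sum-edgeRow G i)) (D-* M i x (identity i)))) ⟩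
      sum (λ i → x * D (M [ i ]≔ identity i))
        ≈⟨ *-distribˡ-sum x (λ i → D (M [ i ]≔ identity i)) ⟨
      x * sum (λ i → D (M [ i ]≔ identity i))
        ≈⟨ *-congˡ (trans (∂-D ∂ ∂-cong ∂-+ ∂-* ∂η≈0 M) (sum-cong-≋ λ i → D-congʳ M i (∂M≈δ i))) ⟨
      x * ∂ (D M) ∎
      where
      L : Matrix Carrier n
      L i j = sum λ k → adjacency G i k * edgeRow b c i k j

    D-edgeDeletion :
      (length (edges G) · 1# - n · 1#) * D M + x * ∂ (D M) ≈
      Σ[ edges G ] (λ e → D (graphMatrix (G ∖ e))) -
      (b * b + η * (c * c)) * Σ[ edges G ] (λ e → D (delete₂ (Edge.s≢t e) M))
    D-edgeDeletion = sym (begin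
      Σ[ edges G ] (λ e → D (graphMatrix (G ∖ e))) - W * Q
        ≈⟨ +-congʳ (begin
             Σ[ edges G ] (λ e → D (graphMatrix (G ∖ e)))       ≈⟨ Σ-cong (edges G) (D-∖ G) ⟩
             Σ[ edges G ] (λ e → (D M + _) + W * _)             ≈⟨ Σ-+ (edges G) _ _ ⟩
             Σ[ edges G ] (λ e → D M + _) + Σ[ edges G ] (λ e → W * _)
               ≈⟨ +-cong (trans (Σ-+ (edges G) _ _) (+-congʳ (Σ-const (edges G) (D M)))) (Σ-* (edges G) W _) ⟩
             (m · D M + firstOrder) + W * Q                     ∎) ⟩
      ((m · D M + firstOrder) + W * Q) - W * Q                  ≈⟨ //-rightDividesʳ (W * Q) _ ⟩
      m · D M + firstOrder                                      ≈⟨ //-rightDividesʳ (n · D M) _ ⟨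
      ((m · D M + firstOrder) + n · D M) - n · D M
        ≈⟨ +-congʳ (trans (+-assoc _ _ _) (+-congˡ firstOrder-deriv)) ⟩
      (m · D M + x * ∂ (D M)) - n · D M                         ≈⟨ xy∙z≈xz∙y _ _ _ ⟩
      (m · D M - n · D M) + x * ∂ (D M)                         ≈⟨ +-congʳ (+-cong (·1* m) (-‿cong (·1* n))) ⟨
      (m · 1# * D M - n · 1# * D M) + x * ∂ (D M)               ≈⟨ +-congʳ ([y-z]x≈yx-zx (D M) _ _) ⟨
      (m · 1# - n · 1#) * D M + x * ∂ (D M)                     ∎)
      where
      m = length (edges G)
      W = b * b + η * (c * c)
      Q = Σ[ edges G ] (λ e → D (delete₂ (Edge.s≢t e) M))
      ·1* : ∀ k → k · 1# * D M ≈ k · D M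
      ·1* k = trans (×-assoc-* k 1# (D M)) (×-congʳ k (*-identityˡ (D M)))

module _ {c ℓ} (R : CommutativeRing c ℓ) where
  open CommutativeRing R hiding (zero)
  open GraphPolynomials R
  open PolynomialRing R
  private module P = CommutativeRing polynomialRing
  open Algebra.Properties.Semiring.Mult P.semiring using () renaming (_×_ to _·ₚ_)
  open Algebra.Properties.Semiring.Sum P.semiring using (sum; sum-cong-≋)
  open Algebra.Properties.Ring P.ring using (-1*x≈-x; -‿distribˡ-*; -‿+-comm; -‿involutive)
  open GraphSums polynomialRing
  open Sums polynomialRing
  open SetoidReasoning ≈ₚ-setoid
  open Graph

  const-* : ∀ a b → const (a * b) ≈ₚ const a *ₚ const b
  const-* a b = sym (+-identityʳ (a * b)) ∷-cong ≈ₚ-refl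

  const-fromℕ : ∀ k → const (fromℕ k) ≈ₚ k ·ₚ 1ₚ
  const-fromℕ zero    = 0∷0≈0
  const-fromℕ (suc k) = P.+-congˡ {1ₚ} (const-fromℕ k)

  const-fromℕ-- : ∀ k l → const (fromℕ k - fromℕ l) ≈ₚ k ·ₚ 1ₚ -ₚ l ·ₚ 1ₚ
  const-fromℕ-- k l = P.+-cong (const-fromℕ k) (P.-‿cong (const-fromℕ l))

  sumℕ-·ₚ : ∀ {n} (f : Fin n → Bool) → sumℕ (λ i → ⟦ f i ⟧) ·ₚ 1ₚ ≈ₚ sum (λ i → indicator (f i))
  sumℕ-·ₚ {zero}  f = ≈ₚ-refl
  sumℕ-·ₚ {suc n} f with f zero
  ... | true  = P.+-congˡ {1ₚ} (sumℕ-·ₚ (λ i → f (suc i)))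
  ... | false = sumℕ-·ₚ (λ i → f (suc i))

  const-degree : ∀ {n} (G : Graph n) i → const (fromℕ (degree G i)) ≈ₚ deg G i
  const-degree G i = begin
    const (fromℕ (degree G i))             ≈⟨ const-fromℕ (degree G i) ⟩
    degree G i ·ₚ 1ₚ
      ≡⟨ ≡.cong (_·ₚ 1ₚ) (length-filter-tabulate (λ j → T? (adj G i j)) (λ j → j)) ⟩
    sumℕ (λ j → ⟦ adj G i j ⟧) ·ₚ 1ₚ       ≈⟨ sumℕ-·ₚ (adj G i) ⟩
    deg G i                                ∎

  const-degreeMatrix : ∀ {n} (G : Graph n) i j → const (degreeMatrix G i j) ≈ₚ deg G i *ₚ identity i j
  const-degreeMatrix G i j with does (i Fin.≟ j)
  ... | true  = ≈ₚ-trans (const-degree G i) (≈ₚ-sym (P.*-identityʳ _))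
  ... | false = ≈ₚ-trans 0∷0≈0 (≈ₚ-sym (P.zeroʳ (deg G i)))

  const-adjacencyMatrix : ∀ {n} (G : Graph n) i j → const (adjacencyMatrix G i j) ≈ₚ adjacency G i j
  const-adjacencyMatrix G i j with adj G i j
  ... | true  = ≈ₚ-refl
  ... | false = 0∷0≈0

  delete₂-cong : ∀ {n} {s t : Fin n} (s≢t : s ≢ t) {M N : Matrix Polynomial n} →
                 (∀ i j → M i j ≈ₚ N i j) → ∀ i j → delete₂ s≢t M i j ≈ₚ delete₂ s≢t N i j
  delete₂-cong {1} {zero} {zero} s≢t M≈N = contradiction ≡.refl s≢t
  delete₂-cong {suc (suc n)}     s≢t M≈N i j = M≈N _ _

  module _ (β γ : Carrier) (η : Polynomial) (η*η≈1 : η *ₚ η ≈ₚ 1ₚ) (η′≈0 : deriv η ≈ₚ 0ₚ)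
           {n} (G : Graph n) where
    open LaplaceExpansion polynomialRing η η*η≈1
    open EdgeDeletion polynomialRing η η*η≈1 X (const β) (const γ)

    matrix≈graphMatrix : ∀ (H : Graph n) i j → matrix β γ H i j ≈ₚ graphMatrix H i j
    matrix≈graphMatrix H i j = P.+-cong
      (P.+-congˡ (P.-‿cong (≈ₚ-trans (const-* β _) (P.*-congˡ {const β} (const-degreeMatrix H i j)))))
      (P.-‿cong (≈ₚ-trans (const-* γ _) (P.*-congˡ {const γ} (const-adjacencyMatrix H i j))))

    deriv-matrix : ∀ i j → deriv (matrix β γ G i j) ≈ₚ identity i j
    deriv-matrix i j = begin
      deriv (X *ₚ identity i j -ₚ const d -ₚ const a)
        ≈⟨ ≈ₚ-trans (deriv-+ₚ (X *ₚ identity i j -ₚ const d) (const (- a))) (+ₚ-identityʳ _) ⟩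
      deriv (X *ₚ identity i j -ₚ const d)
        ≈⟨ ≈ₚ-trans (deriv-+ₚ (X *ₚ identity i j) (const (- d))) (+ₚ-identityʳ _) ⟩
      deriv (X *ₚ identity i j)
        ≈⟨ deriv-*ₚ X (identity i j) ⟩
      deriv X *ₚ identity i j +ₚ X *ₚ deriv (identity i j)
        ≈⟨ P.+-cong (P.*-congʳ {identity i j} {deriv X} {1ₚ} (+-identityʳ 1# ∷-cong ≈ₚ-refl))
             (≈ₚ-trans (P.*-congˡ {X} deriv-identity) (P.zeroʳ X)) ⟩
      1ₚ *ₚ identity i j +ₚ 0ₚ
        ≈⟨ ≈ₚ-trans (+ₚ-identityʳ _) (*ₚ-identityˡ (identity i j)) ⟩
      identity i j ∎
      where
      d = β * degreeMatrix G i j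
      a = γ * adjacencyMatrix G i j
      deriv-identity : deriv (identity i j) ≈ₚ 0ₚ
      deriv-identity with does (i Fin.≟ j)
      ... | true  = ≈ₚ-refl
      ... | false = ≈ₚ-refl

    module _ (F : ∀ {n} → Matrix Polynomial n → Polynomial)
             (F≈D : ∀ {n} (M : Matrix Polynomial n) → F M ≈ₚ D M) where

      edgeDeletion : let M = matrix β γ G in
        const (fromℕ (length (edges G)) - fromℕ n) *ₚ F M +ₚ X *ₚ deriv (F M) ≈ₚ
        Σ[ edges G ] (λ e → F (matrix β γ (G ∖ e))) -ₚ
        (const β *ₚ const β +ₚ η *ₚ (const γ *ₚ const γ)) *ₚ Σ[ edges G ] (λ e → F (delete₂ (Edge.s≢t e) M))
      edgeDeletion = begin
        const (fromℕ m - fromℕ n) *ₚ F (matrix β γ G) +ₚ X *ₚ deriv (F (matrix β γ G))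
          ≈⟨ P.+-cong (P.*-cong (const-fromℕ-- m n) (F≈D-graphMatrix G))
               (P.*-congˡ {X} (deriv-cong (F≈D-graphMatrix G))) ⟩
        (m ·ₚ 1ₚ -ₚ n ·ₚ 1ₚ) *ₚ D (graphMatrix G) +ₚ X *ₚ deriv (D (graphMatrix G))
          ≈⟨ D-edgeDeletion deriv deriv-cong deriv-+ₚ deriv-*ₚ η′≈0 G
               (λ i j → ≈ₚ-trans (deriv-cong (≈ₚ-sym (matrix≈graphMatrix G i j))) (deriv-matrix i j)) ⟩
        Σ[ edges G ] (λ e → D (graphMatrix (G ∖ e))) -ₚ
        W *ₚ Σ[ edges G ] (λ e → D (delete₂ (Edge.s≢t e) (graphMatrix G)))
          ≈⟨ P.+-cong (Σ-cong (edges G) (λ e → F≈D-graphMatrix (G ∖ e)))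
               (P.-‿cong (P.*-congˡ {W} (Σ-cong (edges G) λ e →
                 ≈ₚ-trans (F≈D _) (D-cong (delete₂-cong (Edge.s≢t e) (matrix≈graphMatrix G)))))) ⟨
        Σ[ edges G ] (λ e → F (matrix β γ (G ∖ e))) -ₚ
        W *ₚ Σ[ edges G ] (λ e → F (delete₂ (Edge.s≢t e) (matrix β γ G))) ∎
        where
        m = length (edges G)
        W = const β *ₚ const β +ₚ η *ₚ (const γ *ₚ const γ)
        F≈D-graphMatrix : ∀ H → F (matrix β γ H) ≈ₚ D (graphMatrix H)
        F≈D-graphMatrix H = ≈ₚ-trans (F≈D (matrix β γ H)) (D-cong (matrix≈graphMatrix H))

  module _ (β γ : Carrier) {n} (G : Graph n) where
    private
      M : Matrix Polynomial n
      M = matrix β γ G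

      deletions : (Carrier → Carrier → ∀ {n} → Graph n → Polynomial) → Polynomial
      deletions τ = Σ[ edges G ] λ e → τ β γ (G ∖ e)

      minors : (∀ {n} → Matrix Polynomial n → Polynomial) → Polynomial
      minors F = Σ[ edges G ] λ e → F (delete₂ (Edge.s≢t e) M)

    det-edgeDeletion :
      const (fromℕ (length (edges G)) - fromℕ n) *ₚ τ₁ β γ G +ₚ X *ₚ deriv (τ₁ β γ G) ≈ₚ
      Σ[ edges G ] (λ e → τ₁ β γ (G ∖ e)) +ₚ
      const (γ * γ - β * β) *ₚ Σ[ edges G ] (λ e → det (delete₂ (Edge.s≢t e) M))
    det-edgeDeletion = ≈ₚ-trans
      (edgeDeletion β γ (-ₚ 1ₚ) (-1*-1≈1 polynomialRing) ≈ₚ-refl G det (det≈D polynomialRing))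
      (P.+-congˡ {deletions τ₁} (≈ₚ-trans
        (-‿distribˡ-* (const β *ₚ const β +ₚ (-ₚ 1ₚ) *ₚ (const γ *ₚ const γ)) (minors det))
        (P.*-congʳ {minors det} weight)))
      where
      weight : -ₚ (const β *ₚ const β +ₚ (-ₚ 1ₚ) *ₚ (const γ *ₚ const γ)) ≈ₚ const (γ * γ - β * β)
      weight = begin
        -ₚ (const β *ₚ const β +ₚ (-ₚ 1ₚ) *ₚ (const γ *ₚ const γ))
          ≈⟨ P.-‿cong (P.+-cong (const-* β β)
               (≈ₚ-trans (P.-‿cong (const-* γ γ)) (≈ₚ-sym (-1*x≈-x (const γ *ₚ const γ))))) ⟨
        -ₚ (const (β * β) -ₚ const (γ * γ))        ≈⟨ -‿+-comm (const (β * β)) (-ₚ const (γ * γ)) ⟨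
        -ₚ const (β * β) +ₚ -ₚ (-ₚ const (γ * γ))  ≈⟨ P.+-congˡ { -ₚ const (β * β)} (-‿involutive (const (γ * γ))) ⟩
        -ₚ const (β * β) +ₚ const (γ * γ)          ≈⟨ P.+-comm (-ₚ const (β * β)) (const (γ * γ)) ⟩
        const (γ * γ - β * β)                      ∎

    per-edgeDeletion :
      const (fromℕ (length (edges G)) - fromℕ n) *ₚ τ₂ β γ G +ₚ X *ₚ deriv (τ₂ β γ G) ≈ₚ
      Σ[ edges G ] (λ e → τ₂ β γ (G ∖ e)) -ₚ
      const (γ * γ + β * β) *ₚ Σ[ edges G ] (λ e → per (delete₂ (Edge.s≢t e) M))
    per-edgeDeletion = ≈ₚ-trans
      (edgeDeletion β γ 1ₚ (P.*-identityˡ 1ₚ) ≈ₚ-refl G per (per≈D polynomialRing))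
      (P.+-congˡ {deletions τ₂} (P.-‿cong (P.*-congʳ {minors per} weight)))
      where
      weight : const β *ₚ const β +ₚ 1ₚ *ₚ (const γ *ₚ const γ) ≈ₚ const (γ * γ + β * β)
      weight = begin
        const β *ₚ const β +ₚ 1ₚ *ₚ (const γ *ₚ const γ)
          ≈⟨ P.+-cong (const-* β β) (≈ₚ-trans (const-* γ γ) (≈ₚ-sym (*ₚ-identityˡ (const γ *ₚ const γ)))) ⟨
        const (β * β) +ₚ const (γ * γ)             ≈⟨ P.+-comm (const (β * β)) (const (γ * γ)) ⟩
        const (γ * γ + β * β)                      ∎

open import Defs
open import Data.List.Base using (length)
open import Data.Nat.Base using (ℕ)
open import Data.Product.Base using (_×_)
open import Relation.Nullary using (¬_)

theorem3p1 :
  (β γ : ℝ) → ¬ (γ ≃ 0ℝ) → (n : ℕ) (G : Graph n) →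
  let m = length (edges G)
      M = matrix β γ G
  in
  ( const (fromℕ m -ℝ fromℕ n) *ₚ τ₁ β γ G +ₚ X *ₚ deriv (τ₁ β γ G)
    ≈ₚ Σ[ edges G ] (λ e → τ₁ β γ (G ∖ e))
       +ₚ const (γ *ℝ γ -ℝ β *ℝ β) *ₚ Σ[ edges G ] (λ e → det (delete₂ (Edge.s≢t e) M)) )
  ×
  ( const (fromℕ m -ℝ fromℕ n) *ₚ τ₂ β γ G +ₚ X *ₚ deriv (τ₂ β γ G)
    ≈ₚ Σ[ edges G ] (λ e → τ₂ β γ (G ∖ e))
       -ₚ const (γ *ℝ γ +ℝ β *ℝ β) *ₚ Σ[ edges G ] (λ e → per (delete₂ (Edge.s≢t e) M)) )
theorem3p1 β γ _ n G = det-edgeDeletion ℝ-commutativeRing β γ G , per-edgeDeletion ℝ-commutativeRing β γ G
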